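{- For every integer $k\ge 1$, $$|\mathrm{RedVHC}_k(\mathrm{Av}_{3k}(312))| = 2\,\frac{(3k)!}{k!\,(k+1)!\,(k+2)!}.$$
   Context: $S_n$ is the set of permutations $\pi=\pi_1\cdots\pi_n$ of $\{1,\dots,n\}$. $\pi$ is $312$-avoiding if there are no indices $a<b<c$ with $\pi_b<\pi_c<\pi_a$; $\mathrm{Av}_n(312)\subseteq S_n$ is the set of $312$-avoiding permutations of length $n$. The plot of $\pi$ is the set of points $(i,\pi_i)$, $1\le i\le n$. If $\pi_i>\pi_{i+1}$, then $i$ is a descent, $(i,\pi_i)$ is a descent top and $(i+1,\pi_{i+1})$ is a descent bottom. A hook on $\pi$ from $(i,\pi_i)$ to $(j,\pi_j)$, where $i<j$ and $\pi_i<\pi_j$, consists of the vertical segment from $(i,\pi_i)$ up to $(i,\pi_j)$ followed by the horizontal segment from $(i,\pi_j)$ to $(j,\pi_j)$. The point $(i,\pi_i)$ is its southwest (SW) endpoint and $(j,\pi_j)$ its northeast (NE) endpoint. A valid hook configuration on $\pi$ is a set of hooks on $\pi$ such that: (i) the set of SW endpoints of the hooks is exactly the set of descent tops of $\pi$; (ii) no point of the plot lies directly above a hook (for a hook from $(i,\pi_i)$ to $(j,\pi_j)$ there is no $l$ with $i<l<j$ and $\pi_l>\pi_j$); (iii) distinct hooks do not intersect, except at endpoints (the NE endpoint of one hook may be the SW endpoint of another; two hooks sharing the same NE endpoint, or the same SW endpoint, overlap in a segment and are not allowed). It is reduced if every point of the plot is a hook endpoint or a descent bottom (or both). For a set $S$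 of permutations, $\mathrm{RedVHC}_k(S)$ is the set of all reduced valid hook configurations with exactly $k$ hooks on permutations in $S$ (a configuration includes the data of its underlying permutation). -}

module Defs where

open import Data.Fin using (Fin; toℕ; _<_; _>_)
open import Data.Fin.Permutation as Perm using (Permutation′; _⟨$⟩ʳ_)
open import Data.Fin.Subset using (Subset; ∣_∣; _∈_)
open import Data.Integer using (+_)
open import Data.Nat using (ℕ; suc)
open import Data.Product using (∃-syntax; _×_; _,_)
open import Data.Rational using (ℚ; _/_; _≤_)
open import Data.Sum using (_⊎_)
open import Data.Vec as Vec using (Vec; lookup)
open import Function using (_⇔_; Bijection)
open import Level using (0ℓ)
open import Relation.Binary using (Setoid)
open import Relation.Binary.PropositionalEquality
  using (_≡_; refl; sym; trans; setoid)
open import Relation.Nullary using (¬_)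
open import Relation.Unary using (Pred)

private
  variable
    n : ℕ

-- Positions and values are elements of Fin n, so they are 0-based here; only
-- the plot coordinates below are shifted to 1, …, n.

Av312 : ∀ n → Pred (Permutation′ n) 0ℓ
Av312 n π = ¬ (∃[ a ] ∃[ b ] ∃[ c ] (a < b × b < c ×
  π ⟨$⟩ʳ b < π ⟨$⟩ʳ c × π ⟨$⟩ʳ c < π ⟨$⟩ʳ a))

DescentAt : Permutation′ n → Fin n → Fin n → Set
DescentAt π i i⁺ = toℕ i⁺ ≡ suc (toℕ i) × π ⟨$⟩ʳ i > π ⟨$⟩ʳ i⁺

IsDescentTop : Permutation′ n → Fin n → Set
IsDescentTop π i = ∃[ i⁺ ] DescentAt π i i⁺

IsDescentBottom : Permutation′ n → Fin n → Set
IsDescentBottom π j = ∃[ j⁻ ] DescentAt π j⁻ j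

-- The drawing takes place in ℚ². Hooks consist of axis-parallel segments with
-- integer endpoints, so passing to ℝ² would create no further intersections.

Point : Set
Point = ℚ × ℚ

coord : Fin n → ℚ
coord i = + suc (toℕ i) / 1

plotPoint : Permutation′ n → Fin n → Point
plotPoint π i = coord i , coord (π ⟨$⟩ʳ i)

-- A hook is identified with the positions (i , j) of its SW and NE endpoints.

IsHook : Permutation′ n → Fin n × Fin n → Set
IsHook π (i , j) = i < j × π ⟨$⟩ʳ i < π ⟨$⟩ʳ j

OnVertical : Permutation′ n → Fin n × Fin n → Pred Point 0ℓ
OnVertical π (i , j) (x , y) =
  x ≡ coord i × coord (π ⟨$⟩ʳ i) ≤ y × y ≤ coord (π ⟨$⟩ʳ j)

OnHorizontal : Permutation′ n → Fin n × Fin n → Pred Point 0ℓ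
OnHorizontal π (i , j) (x , y) =
  coord i ≤ x × x ≤ coord j × y ≡ coord (π ⟨$⟩ʳ j)

OnHook : Permutation′ n → Fin n × Fin n → Pred Point 0ℓ
OnHook π h p = OnVertical π h p ⊎ OnHorizontal π h p

IsEndpoint : Permutation′ n → Fin n × Fin n → Pred Point 0ℓ
IsEndpoint π (i , j) p = p ≡ plotPoint π i ⊎ p ≡ plotPoint π j

-- A finite set of pairs (i , j), as an n × n incidence matrix: row i is the set
-- of all j with (i , j) in the set. Extensional equality of such sets is _≡_.

PairSet : ℕ → Set
PairSet n = Vec (Subset n) n

infix 4 _∈ₚ_

_∈ₚ_ : Fin n × Fin n → PairSet n → Set
(i , j) ∈ₚ H = j ∈ lookup H i

size : PairSet n → ℕ
size H = Vec.sum (Vec.map ∣_∣ H)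

record IsValidHookConfiguration (π : Permutation′ n) (H : PairSet n) : Set where
  field
    areHooks       : ∀ h → h ∈ₚ H → IsHook π h
    swEndpoints    : ∀ i → (∃[ j ] (i , j) ∈ₚ H) ⇔ IsDescentTop π i
    noPointAbove   : ∀ i j → (i , j) ∈ₚ H →
                     ¬ (∃[ l ] (i < l × l < j × π ⟨$⟩ʳ l > π ⟨$⟩ʳ j))
    noIntersection : ∀ h h′ → h ∈ₚ H → h′ ∈ₚ H → ¬ (h ≡ h′) →
                     ∀ p → OnHook π h p → OnHook π h′ p →
                     IsEndpoint π h p × IsEndpoint π h′ p

IsReduced : Permutation′ n → PairSet n → Set
IsReduced π H = ∀ i →
  (∃[ j ] (i , j) ∈ₚ H) ⊎ (∃[ j ] (j , i) ∈ₚ H) ⊎ IsDescentBottom π i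

record RedVHC (k : ℕ) (S : Pred (Permutation′ n) 0ℓ) : Set where
  field
    perm    : Permutation′ n
    perm∈S  : S perm
    hooks   : PairSet n
    isVHC   : IsValidHookConfiguration perm hooks
    reduced : IsReduced perm hooks
    size≡k  : size hooks ≡ k

-- Two configurations are equal when their permutations and their hook sets
-- agree; the proof components are not compared.

redVHC-setoid : ℕ → Pred (Permutation′ n) 0ℓ → Setoid 0ℓ 0ℓ
redVHC-setoid k S = record
  { Carrier       = RedVHC k S
  ; _≈_           = λ C D → perm C Perm.≈ perm D × hooks C ≡ hooks D
  ; isEquivalence = record
    { refl  = (λ _ → refl) , refl
    ; sym   = λ (p , q) → (λ i → sym (p i)) , sym q
    ; trans = λ (p , q) (p′ , q′) → (λ i → trans (p i) (p′ i)) , trans q q′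
    }
  }
  where open RedVHC

HasCardinality : Setoid 0ℓ 0ℓ → ℕ → Set
HasCardinality A N = Bijection (setoid (Fin N)) A

-- Each of the k hooks contributes one SW endpoint, one NE endpoint and, via its descent, one
-- descent bottom; as these cover all 3k points, every point has exactly one of the three
-- roles. Labelling the values 1, …, 3k in increasing order by 1 (descent bottom), 2 (SW) and
-- 3 (NE) yields a ballot word: a descent bottom is smaller than its descent top, which is
-- smaller than its NE endpoint.
--
-- The word determines the configuration. Avoiding 312 makes all points except the descent
-- bottoms left-to-right maxima, so the configuration is the output of a machine reading the
-- word: letter 1 pushes the current value on a stack; letter 2 writes the current value and
-- then the value popped from the stack, and opens a hook; letter 3 writes the current value
-- and closes the hook opened last. Ballot words are counted by the hook length formula for
-- the 3 × k rectangle.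

module Submission where

open import Defs
open import Data.Nat using (ℕ; _+_; _*_; _≥_; _!)
open import Data.Product using (∃-syntax; _×_)
open import Relation.Binary.PropositionalEquality using (_≡_)

open import Data.Bool using (Bool; true; false; if_then_else_)
open import Data.Empty using (⊥; ⊥-elim)
open import Data.Fin as Fin using (Fin; zero; suc; toℕ; inject₁; fromℕ<)
open import Data.Fin.Permutation as Perm
  using (Permutation′; permutation; _⟨$⟩ʳ_; _⟨$⟩ˡ_; inverseʳ)
open import Data.Fin.Properties as Fin
  using (toℕ-injective; toℕ-inject₁; toℕ<n; toℕ-fromℕ<; +↔⊎; 0↔⊥; 1↔⊤)
open import Data.Fin.Subset using (Subset; ∣_∣)
open import Data.Fin.Subset.Properties using (⊆-antisym)
import Data.Integer as ℤ
import Data.Integer.Properties as ℤ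
open import Data.List as List using (List)
open import Data.List.Properties using (∷-injectiveʳ)
open import Data.Nat using (zero; suc; _≤_; _<_; z≤n; s≤s; _≟_)
import Data.Nat.Coprimality as Coprime
open import Data.Nat.Properties
open import Data.Nat.Tactic.RingSolver using (solve-∀)
open import Data.Product using (∃₂; Σ-syntax; _,_; proj₁; proj₂)
open import Data.Rational as ℚ using (mkℚ; *≤*)
import Data.Rational.Properties as ℚ
open import Data.Sum using (_⊎_; inj₁; inj₂; [_,_]′)
open import Data.Sum.Function.Propositional using (_⊎-↔_)
open import Data.Unit using (⊤; tt)
open import Data.Vec as Vec using (Vec; []; _∷_; head; tail; lookup; tabulate)
open import Data.Vec.Membership.Propositional using () renaming (_∈_ to _∈ᵥ_)
open import Data.Vec.Properties
  using ([]=⇒lookup; lookup⇒[]=; lookup∘tabulate; tabulate∘lookup; tabulate-cong)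
open import Data.Vec.Relation.Unary.Any using (here; there)
open import Function using (_∘_; _↔_; mk↔ₛ′; mk⇔; Equivalence; Injection; Inverse)
open import Function.Construct.Composition using (_↔-∘_)
open import Function.Properties.Inverse using (↔⇒↣)
open import Relation.Binary using (Setoid)
open import Relation.Binary.Definitions using (Tri; tri<; tri≈; tri>)
open import Relation.Binary.PropositionalEquality
open import Relation.Nullary
open import Relation.Nullary.Decidable using (_⊎-dec_; _×-dec_; dec-true; dec-false)
open import Algebra.Properties.CommutativeMonoid.Sum +-0-commutativeMonoid
  using (sum; sum-syntax; sum-cong-≗; ∑-distrib-+; ∑-comm; sum-init-last; sum-replicate-zero)

private
  variable
    k n x y z x′ y′ z′ i i′ j j′ l s t u v v′ : ℕ

-- Ballot words

-- A word in Ballot x y z has x + y + z letters 1, y + z letters 2 and z letters 3. Indexing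
-- by the excesses x and y turns the ballot condition on prefixes into well-typedness.
data Ballot : ℕ → ℕ → ℕ → Set where
  ε     : Ballot 0 0 0
  _▹₁   : ∀ {x y z} → Ballot x y z → Ballot (suc x) y z
  _▹₂   : ∀ {x y z} → Ballot (suc x) y z → Ballot x (suc y) z
  _▹₃   : ∀ {x y z} → Ballot x (suc y) z → Ballot x y (suc z)

infixl 20 _▹₁ _▹₂ _▹₃

-- Counting ballot words by their last letter.

count empty# last₁# last₂# last₃# : ℕ → ℕ → ℕ → ℕ
count x y z = empty# x y z + (last₁# x y z + (last₂# x y z + last₃# x y z))
empty# zero zero zero = 1
empty# zero zero (suc z) = 0
empty# zero (suc y) z = 0
empty# (suc x) y z = 0
last₁# zero y z = 0
last₁# (suc x) y z = count x y z
last₂# x zero z = 0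
-- `x` grows here, and `y` grows in `last₃#`; the recursion terminates because `(z, y, x)` decreases
-- lexicographically.
last₂# x (suc y) z = count (suc x) y z
last₃# x y zero = 0
last₃# x y (suc z) = count x (suc y) z

-- Types following the equations of the four counters, with `⊥` where a counter is 0, so that the
-- bijection with `Fin (count x y z)` can be built summand by summand.
Empty Last₁ Last₂ Last₃ : ℕ → ℕ → ℕ → Set
Empty zero zero zero = ⊤
Empty zero zero (suc z) = ⊥
Empty zero (suc y) z = ⊥
Empty (suc x) y z = ⊥
Last₁ zero y z = ⊥
Last₁ (suc x) y z = Ballot x y z
Last₂ x zero z = ⊥
Last₂ x (suc y) z = Ballot (suc x) y z
Last₃ x y zero = ⊥
Last₃ x y (suc z) = Ballot x (suc y) z

split : ∀ {x y z} → Ballot x y z →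
        Empty x y z ⊎ Last₁ x y z ⊎ Last₂ x y z ⊎ Last₃ x y z
split ε      = inj₁ tt
split (w ▹₁) = inj₂ (inj₁ w)
split (w ▹₂) = inj₂ (inj₂ (inj₁ w))
split (w ▹₃) = inj₂ (inj₂ (inj₂ w))

unsplit₀ : ∀ x y z → Empty x y z → Ballot x y z
unsplit₀ zero zero zero _ = ε

unsplit₁ : ∀ x y z → Last₁ x y z → Ballot x y z
unsplit₁ (suc x) y z w = w ▹₁

unsplit₂ : ∀ x y z → Last₂ x y z → Ballot x y z
unsplit₂ x (suc y) z w = w ▹₂

unsplit₃ : ∀ x y z → Last₃ x y z → Ballot x y z
unsplit₃ x y (suc z) w = w ▹₃

unsplit : ∀ x y z → Empty x y z ⊎ Last₁ x y z ⊎ Last₂ x y z ⊎ Last₃ x y z → Ballot x y z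
unsplit x y z (inj₁ e) = unsplit₀ x y z e
unsplit x y z (inj₂ (inj₁ w)) = unsplit₁ x y z w
unsplit x y z (inj₂ (inj₂ (inj₁ w))) = unsplit₂ x y z w
unsplit x y z (inj₂ (inj₂ (inj₂ w))) = unsplit₃ x y z w

split-unsplit : ∀ x y z s → split (unsplit x y z s) ≡ s
split-unsplit zero zero zero (inj₁ _) = refl
split-unsplit zero zero (suc z) (inj₁ ())
split-unsplit zero (suc y) z (inj₁ ())
split-unsplit (suc x) y z (inj₁ ())
split-unsplit zero y z (inj₂ (inj₁ ()))
split-unsplit (suc x) y z (inj₂ (inj₁ w)) = refl
split-unsplit x zero z (inj₂ (inj₂ (inj₁ ())))
split-unsplit x (suc y) z (inj₂ (inj₂ (inj₁ w))) = refl
split-unsplit x y zero (inj₂ (inj₂ (inj₂ ())))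
split-unsplit x y (suc z) (inj₂ (inj₂ (inj₂ w))) = refl

unsplit-split : ∀ {x y z} (w : Ballot x y z) → unsplit x y z (split w) ≡ w
unsplit-split ε      = refl
unsplit-split (w ▹₁) = refl
unsplit-split (w ▹₂) = refl
unsplit-split (w ▹₃) = refl

count↔ : ∀ x y z → Fin (count x y z) ↔ Ballot x y z
empty↔ : ∀ x y z → Fin (empty# x y z) ↔ Empty x y z
last₁↔ : ∀ x y z → Fin (last₁# x y z) ↔ Last₁ x y z
last₂↔ : ∀ x y z → Fin (last₂# x y z) ↔ Last₂ x y z
last₃↔ : ∀ x y z → Fin (last₃# x y z) ↔ Last₃ x y z
count↔ x y z =
  mk↔ₛ′ (unsplit x y z) split unsplit-split (split-unsplit x y z) ↔-∘
  ((empty↔ x y z ⊎-↔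
    ((last₁↔ x y z ⊎-↔
      ((last₂↔ x y z ⊎-↔ last₃↔ x y z) ↔-∘ +↔⊎)) ↔-∘ +↔⊎)) ↔-∘ +↔⊎)
empty↔ zero zero zero = 1↔⊤
empty↔ zero zero (suc z) = 0↔⊥
empty↔ zero (suc y) z = 0↔⊥
empty↔ (suc x) y z = 0↔⊥
last₁↔ zero y z = 0↔⊥
last₁↔ (suc x) y z = count↔ x y z
last₂↔ x zero z = 0↔⊥
last₂↔ x (suc y) z = count↔ (suc x) y z
last₃↔ x y zero = 0↔⊥
last₃↔ x y (suc z) = count↔ x (suc y) z

-- The denominator in Frobenius' form of the hook length formula: the factorials of the shifted row
-- lengths `2 + x + y + z`, `1 + y + z` and `z`. The differences of these lengths are the factors
-- `1 + x`, `1 + y` and `2 + x + y` of the numerator.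
den : ℕ → ℕ → ℕ → ℕ
den x y z = (2 + x + y + z) ! * (1 + y + z) ! * z !

-- The hook length formula for the shape (x + y + z, y + z, z) with denominators cleared. The
-- right-hand sides for last₁#, last₂# and last₃# vanish where these counts do, so that the
-- recursion has no boundary cases.
count-formula : ∀ n x y z → x + 2 * y + 3 * z ≡ n →
  count x y z * den x y z ≡ n ! * ((1 + x) * (1 + y) * (2 + x + y))
last₁-formula : ∀ n x y z → x + 2 * y + 3 * z ≡ suc n →
  last₁# x y z * den x y z ≡ n ! * ((2 + x + y + z) * (x * (1 + y) * (1 + x + y)))
last₂-formula : ∀ n x y z → x + 2 * y + 3 * z ≡ suc n →
  last₂# x y z * den x y z ≡ n ! * ((1 + y + z) * ((2 + x) * y * (2 + x + y)))
last₃-formula : ∀ n x y z → x + 2 * y + 3 * z ≡ suc n →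
  last₃# x y z * den x y z ≡ n ! * (z * ((1 + x) * (2 + y) * (3 + x + y)))

count-formula zero    zero zero zero eq = refl
count-formula (suc n) x y z eq = begin
  (empty# x y z + (a + (b + c))) * d
    ≡⟨ cong (λ e → (e + (a + (b + c))) * d) (empty≡0 x y z eq) ⟩
  (a + (b + c)) * d
    ≡⟨ distrib a b c d ⟩
  a * d + (b * d + c * d)
    ≡⟨ cong₂ _+_ (last₁-formula n x y z eq) (cong₂ _+_ (last₂-formula n x y z eq) (last₃-formula n x y z eq)) ⟩
  -- The length `x + 2 * y + 3 * z` of the word splits off as a factor, and it turns `n !` into
  -- `suc n !`.
  _ ≡⟨ collect (n !) x y z ⟩
  (x + 2 * y + 3 * z) * n ! * ((1 + x) * (1 + y) * (2 + x + y))
    ≡⟨ cong (λ m → m * n ! * ((1 + x) * (1 + y) * (2 + x + y))) eq ⟩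
  suc n ! * ((1 + x) * (1 + y) * (2 + x + y)) ∎
  where
  open ≡-Reasoning
  a = last₁# x y z
  b = last₂# x y z
  c = last₃# x y z
  d = den x y z
  empty≡0 : ∀ x y z → x + 2 * y + 3 * z ≡ suc n → empty# x y z ≡ 0
  empty≡0 zero zero (suc z) _ = refl
  empty≡0 zero (suc y) z _ = refl
  empty≡0 (suc x) y z _ = refl
  distrib : ∀ a b c d → (a + (b + c)) * d ≡ a * d + (b * d + c * d)
  distrib = solve-∀
  collect : ∀ f x y z →
    f * ((2 + x + y + z) * (x * (1 + y) * (1 + x + y))) +
    (f * ((1 + y + z) * ((2 + x) * y * (2 + x + y))) +
     f * (z * ((1 + x) * (2 + y) * (3 + x + y))))
    ≡ (x + 2 * y + 3 * z) * f * ((1 + x) * (1 + y) * (2 + x + y))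
  collect = solve-∀

last₁-formula n zero y z eq = sym (trans (cong (n ! *_) (*-zeroʳ (2 + y + z))) (*-zeroʳ (n !)))
last₁-formula n (suc x) y z eq = begin
  count x y z * ((3 + x + y + z) * (2 + x + y + z) ! * (1 + y + z) ! * z !)
    -- Removing a letter shortens a single row of the shape, so `den` loses a single factor. The
    -- same happens in the next two formulas, for the second and the third row.
    ≡⟨ regroup (count x y z) (3 + x + y + z) ((2 + x + y + z) !) ((1 + y + z) !) (z !) ⟩
  (3 + x + y + z) * (count x y z * den x y z)
    ≡⟨ cong ((3 + x + y + z) *_) (count-formula n x y z (suc-injective eq)) ⟩
  (3 + x + y + z) * (n ! * ((1 + x) * (1 + y) * (2 + x + y)))
    ≡⟨ finish (3 + x + y + z) (n !) ((1 + x) * (1 + y) * (2 + x + y)) ⟩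
  n ! * ((3 + x + y + z) * ((1 + x) * (1 + y) * (2 + x + y))) ∎
  where
  open ≡-Reasoning
  regroup : ∀ c s p q r → c * (s * p * q * r) ≡ s * (c * (p * q * r))
  regroup = solve-∀
  finish : ∀ s f t → s * (f * t) ≡ f * (s * t)
  finish = solve-∀

last₂-formula n x zero z eq =
  sym (trans (cong (λ t → n ! * ((1 + z) * (t * (2 + x + 0)))) (*-zeroʳ (2 + x)))
      (trans (cong (n ! *_) (*-zeroʳ (1 + z))) (*-zeroʳ (n !))))
last₂-formula n x (suc y) z eq = begin
  count (suc x) y z * ((2 + x + suc y + z) ! * ((2 + y + z) * (1 + y + z) !) * z !)
    ≡⟨ cong (λ t → count (suc x) y z * ((2 + t + z) ! * ((2 + y + z) * (1 + y + z) !) * z !)) (+-suc x y) ⟩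
  count (suc x) y z * ((3 + x + y + z) ! * ((2 + y + z) * (1 + y + z) !) * z !)
    ≡⟨ regroup (count (suc x) y z) (2 + y + z) ((3 + x + y + z) !) ((1 + y + z) !) (z !) ⟩
  (2 + y + z) * (count (suc x) y z * den (suc x) y z)
    ≡⟨ cong ((2 + y + z) *_) (count-formula n (suc x) y z (suc-injective (trans (shift x y z) eq))) ⟩
  (2 + y + z) * (n ! * ((2 + x) * (1 + y) * (3 + x + y)))
    ≡⟨ finish (2 + y + z) (n !) x y ⟩
  n ! * ((2 + y + z) * ((2 + x) * (1 + y) * (2 + x + suc y))) ∎
  where
  open ≡-Reasoning
  regroup : ∀ c s p q r → c * (p * (s * q) * r) ≡ s * (c * (p * q * r))
  regroup = solve-∀
  finish : ∀ s f x y → s * (f * ((2 + x) * (1 + y) * (3 + x + y))) ≡ f * (s * ((2 + x) * (1 + y) * (2 + x + suc y)))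
  finish = solve-∀
  shift : ∀ x y z → suc (suc x + 2 * y + 3 * z) ≡ x + 2 * suc y + 3 * z
  shift = solve-∀

last₃-formula n x y zero eq = sym (*-zeroʳ (n !))
last₃-formula n x y (suc z) eq = begin
  count x (suc y) z * ((2 + x + y + suc z) ! * (1 + y + suc z) ! * (suc z * z !))
    ≡⟨ cong₂ (λ s t → count x (suc y) z * ((2 + s) ! * (1 + t) ! * (suc z * z !))) (move-suc x y z) (+-suc y z) ⟩
  count x (suc y) z * ((2 + x + suc y + z) ! * (2 + y + z) ! * (suc z * z !))
    ≡⟨ regroup (count x (suc y) z) (suc z) ((2 + x + suc y + z) !) ((2 + y + z) !) (z !) ⟩
  suc z * (count x (suc y) z * den x (suc y) z)
    ≡⟨ cong (suc z *_) (count-formula n x (suc y) z (suc-injective (trans (shift x y z) eq))) ⟩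
  suc z * (n ! * ((1 + x) * (2 + y) * (2 + x + suc y)))
    ≡⟨ finish (suc z) (n !) x y ⟩
  n ! * (suc z * ((1 + x) * (2 + y) * (3 + x + y))) ∎
  where
  open ≡-Reasoning
  regroup : ∀ c s p q r → c * (p * q * (s * r)) ≡ s * (c * (p * q * r))
  regroup = solve-∀
  finish : ∀ s f x y → s * (f * ((1 + x) * (2 + y) * (2 + x + suc y))) ≡ f * (s * ((1 + x) * (2 + y) * (3 + x + y)))
  finish = solve-∀
  shift : ∀ x y z → suc (x + 2 * suc y + 3 * z) ≡ x + 2 * y + 3 * suc z
  shift = solve-∀
  move-suc : ∀ x y z → x + y + suc z ≡ x + suc y + z
  move-suc = solve-∀

count-00k : ∀ k → count 0 0 k * (k ! * (k + 1) ! * (k + 2) !) ≡ 2 * (3 * k) !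
count-00k k = begin
  count 0 0 k * (k ! * (k + 1) ! * (k + 2) !)
    ≡⟨ cong₂ (λ s t → count 0 0 k * (k ! * s ! * t !)) (+-comm k 1) (+-comm k 2) ⟩
  count 0 0 k * (k ! * (1 + k) ! * (2 + k) !)
    ≡⟨ cong (count 0 0 k *_) (regroup (k !) ((1 + k) !) ((2 + k) !)) ⟩
  count 0 0 k * den 0 0 k
    ≡⟨ count-formula (3 * k) 0 0 k refl ⟩
  (3 * k) ! * 2
    ≡⟨ *-comm ((3 * k) !) 2 ⟩
  2 * (3 * k) ! ∎
  where
  open ≡-Reasoning
  regroup : ∀ a b c → a * b * c ≡ c * b * a
  regroup = solve-∀

-- The machine reading a ballot word

Descending : Vec ℕ n → Set
Descending []       = ⊤
Descending (s ∷ ss) = (∀ {t} → t ∈ᵥ ss → t < s) × Descending ss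

tail-descending : (ss : Vec ℕ (suc n)) → Descending ss → Descending (tail ss)
tail-descending (_ ∷ _) = proj₂

tail<head : (ss : Vec ℕ (suc n)) → Descending ss → t ∈ᵥ tail ss → t < head ss
tail<head (_ ∷ _) (below , _) = below

∈-tail : (ss : Vec ℕ (suc n)) → t ∈ᵥ tail ss → t ∈ᵥ ss
∈-tail (_ ∷ _) = there

head-∈ : (ss : Vec ℕ (suc n)) → head ss ∈ᵥ ss
head-∈ (_ ∷ _) = here refl

∉-empty : (ss : Vec ℕ 0) → ¬ t ∈ᵥ ss
∉-empty [] ()

∈-uncons : (ss : Vec ℕ (suc n)) → t ∈ᵥ ss → t ≡ head ss ⊎ t ∈ᵥ tail ss
∈-uncons (_ ∷ _) (here eq) = inj₁ eq
∈-uncons (_ ∷ _) (there m) = inj₂ m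

-- How many values have been read and how many positions written. Counting from 0, these are also
-- the current value and the next free position.
values positions : Ballot x y z → ℕ
values ε      = 0
values (w ▹₁) = suc (values w)
values (w ▹₂) = suc (values w)
values (w ▹₃) = suc (values w)
positions ε      = 0
positions (w ▹₁) = positions w
positions (w ▹₂) = 2 + positions w
positions (w ▹₃) = suc (positions w)

-- The stack of values that were pushed and not yet written.
pending : Ballot x y z → Vec ℕ x
pending ε      = []
pending (w ▹₁) = values w ∷ pending w
pending (w ▹₂) = tail (pending w)
pending (w ▹₃) = pending w

-- The positions of the SW endpoints whose hooks are still open, the last one first.
unmatched : Ballot x y z → Vec ℕ y
unmatched ε      = []
unmatched (w ▹₁) = unmatched w
unmatched (w ▹₂) = positions w ∷ unmatched w
unmatched (w ▹₃) = tail (unmatched w)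

-- At w i v says that w makes the machine write the value v at position i.
At : Ballot x y z → ℕ → ℕ → Set
At ε      i v = ⊥
At (w ▹₁) i v = At w i v
At (w ▹₂) i v = At w i v ⊎ (i ≡ positions w × v ≡ values w) ⊎
                (i ≡ suc (positions w) × v ≡ head (pending w))
At (w ▹₃) i v = At w i v ⊎ (i ≡ positions w × v ≡ values w)

Top : Ballot x y z → ℕ → Set
Top ε      i = ⊥
Top (w ▹₁) i = Top w i
Top (w ▹₂) i = Top w i ⊎ i ≡ positions w
Top (w ▹₃) i = Top w i

Hook : Ballot x y z → ℕ → ℕ → Set
Hook ε      i j = ⊥
Hook (w ▹₁) i j = Hook w i j
Hook (w ▹₂) i j = Hook w i j
Hook (w ▹₃) i j = Hook w i j ⊎ (i ≡ head (unmatched w) × j ≡ positions w)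

hook? : (w : Ballot x y z) → ∀ i j → Dec (Hook w i j)
hook? ε      i j = no λ ()
hook? (w ▹₁) i j = hook? w i j
hook? (w ▹₂) i j = hook? w i j
hook? (w ▹₃) i j = hook? w i j ⊎-dec ((i ≟ head (unmatched w)) ×-dec (j ≟ positions w))

-- Bounds and order of the two stacks.

pending-< : (w : Ballot x y z) → u ∈ᵥ pending w → u < values w
pending-< (w ▹₁) (here refl) = ≤-refl
pending-< (w ▹₁) (there m)   = m<n⇒m<1+n (pending-< w m)
pending-< (w ▹₂) m           = m<n⇒m<1+n (pending-< w (∈-tail (pending w) m))
pending-< (w ▹₃) m           = m<n⇒m<1+n (pending-< w m)

pending-descending : (w : Ballot x y z) → Descending (pending w)
pending-descending ε      = tt
pending-descending (w ▹₁) = pending-< w , pending-descending w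
pending-descending (w ▹₂) = tail-descending (pending w) (pending-descending w)
pending-descending (w ▹₃) = pending-descending w

unmatched-< : (w : Ballot x y z) → i ∈ᵥ unmatched w → i < positions w
unmatched-< (w ▹₁) m           = unmatched-< w m
unmatched-< (w ▹₂) (here refl) = m≤n+m _ 1
unmatched-< (w ▹₂) (there m)   = m<n⇒m<1+n (m<n⇒m<1+n (unmatched-< w m))
unmatched-< (w ▹₃) m           = m<n⇒m<1+n (unmatched-< w (∈-tail (unmatched w) m))

unmatched-descending : (w : Ballot x y z) → Descending (unmatched w)
unmatched-descending ε      = tt
unmatched-descending (w ▹₁) = unmatched-descending w
unmatched-descending (w ▹₂) = unmatched-< w , unmatched-descending w
unmatched-descending (w ▹₃) = tail-descending (unmatched w) (unmatched-descending w)

-- The output as a partial permutation.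

at-< : (w : Ballot x y z) → At w i v → i < positions w × v < values w
at-< (w ▹₁) a with at-< w a
... | p , q = p , m<n⇒m<1+n q
at-< (w ▹₂) (inj₁ a) with at-< w a
... | p , q = m<n⇒m<1+n (m<n⇒m<1+n p) , m<n⇒m<1+n q
at-< (w ▹₂) (inj₂ (inj₁ (refl , refl))) = m≤n+m _ 1 , ≤-refl
at-< (w ▹₂) (inj₂ (inj₂ (refl , refl))) =
  ≤-refl , m<n⇒m<1+n (pending-< w (head-∈ (pending w)))
at-< (w ▹₃) (inj₁ a) with at-< w a
... | p , q = m<n⇒m<1+n p , m<n⇒m<1+n q
at-< (w ▹₃) (inj₂ (refl , refl)) = ≤-refl , ≤-refl

position-< : (w : Ballot x y z) → At w i v → i < positions w
position-< w a = proj₁ (at-< w a)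

value-< : (w : Ballot x y z) → At w i v → v < values w
value-< w a = proj₂ (at-< w a)

at-old₂ : (w : Ballot (suc x) y z) → i < positions w → At (w ▹₂) i v → At w i v
at-old₂ w i<p (inj₁ a)                   = a
at-old₂ w i<p (inj₂ (inj₁ (refl , _)))   = ⊥-elim (n≮n _ i<p)
at-old₂ w i<p (inj₂ (inj₂ (refl , _)))   = ⊥-elim (1+n≰n (<⇒≤ i<p))

at-old₃ : (w : Ballot x (suc y) z) → i < positions w → At (w ▹₃) i v → At w i v
at-old₃ w i<p (inj₁ a)          = a
at-old₃ w i<p (inj₂ (refl , _)) = ⊥-elim (n≮n _ i<p)

-- A written value is either the current one, which was never pushed, or the popped one, which
-- exceeds whatever stays on the stack.
at-∉-pending : (w : Ballot x y z) → At w i v → ¬ v ∈ᵥ pending w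
at-∉-pending (w ▹₁) a (here refl) = n≮n _ (value-< w a)
at-∉-pending (w ▹₁) a (there m)   = at-∉-pending w a m
at-∉-pending (w ▹₂) (inj₁ a) m    = at-∉-pending w a (∈-tail (pending w) m)
at-∉-pending (w ▹₂) (inj₂ (inj₁ (_ , refl))) m =
  n≮n _ (pending-< w (∈-tail (pending w) m))
at-∉-pending (w ▹₂) (inj₂ (inj₂ (_ , refl))) m =
  n≮n _ (tail<head (pending w) (pending-descending w) m)
at-∉-pending (w ▹₃) (inj₁ a) m          = at-∉-pending w a m
at-∉-pending (w ▹₃) (inj₂ (_ , refl)) m = n≮n _ (pending-< w m)

at-functional : (w : Ballot x y z) → At w i v → At w i v′ → v ≡ v′
at-functional (w ▹₁) a a′ = at-functional w a a′
at-functional (w ▹₂) (inj₁ a) a′ = at-functional w a (at-old₂ w (position-< w a) a′)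
at-functional (w ▹₂) a (inj₁ a′) = at-functional w (at-old₂ w (position-< w a′) a) a′
at-functional (w ▹₂) (inj₂ (inj₁ (_ , refl))) (inj₂ (inj₁ (_ , refl))) = refl
at-functional (w ▹₂) (inj₂ (inj₂ (_ , refl))) (inj₂ (inj₂ (_ , refl))) = refl
at-functional (w ▹₂) (inj₂ (inj₁ (refl , _))) (inj₂ (inj₂ (eq , _))) = ⊥-elim (1+n≢n (sym eq))
at-functional (w ▹₂) (inj₂ (inj₂ (refl , _))) (inj₂ (inj₁ (eq , _))) = ⊥-elim (1+n≢n eq)
at-functional (w ▹₃) (inj₁ a) a′ = at-functional w a (at-old₃ w (position-< w a) a′)
at-functional (w ▹₃) a (inj₁ a′) = at-functional w (at-old₃ w (position-< w a′) a) a′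
at-functional (w ▹₃) (inj₂ (_ , refl)) (inj₂ (_ , refl)) = refl

at-≢-head : (w : Ballot (suc x) y z) → At w i v → v ≢ head (pending w)
at-≢-head w a refl = at-∉-pending w a (head-∈ (pending w))

head-≢-values : (w : Ballot (suc x) y z) → v ≡ head (pending w) → v ≢ values w
head-≢-values w refl = <⇒≢ (pending-< w (head-∈ (pending w)))

at-injective : (w : Ballot x y z) → At w i v → At w i′ v → i ≡ i′
at-injective (w ▹₁) a a′ = at-injective w a a′
at-injective (w ▹₂) (inj₁ a) (inj₁ a′) = at-injective w a a′
at-injective (w ▹₂) (inj₁ a) (inj₂ (inj₁ (_ , eq))) = ⊥-elim (<⇒≢ (value-< w a) eq)
at-injective (w ▹₂) (inj₁ a) (inj₂ (inj₂ (_ , eq))) = ⊥-elim (at-≢-head w a eq)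
at-injective (w ▹₂) (inj₂ (inj₁ (_ , eq))) (inj₁ a) = ⊥-elim (<⇒≢ (value-< w a) eq)
at-injective (w ▹₂) (inj₂ (inj₂ (_ , eq))) (inj₁ a) = ⊥-elim (at-≢-head w a eq)
at-injective (w ▹₂) (inj₂ (inj₁ (refl , _))) (inj₂ (inj₁ (refl , _))) = refl
at-injective (w ▹₂) (inj₂ (inj₂ (refl , _))) (inj₂ (inj₂ (refl , _))) = refl
at-injective (w ▹₂) (inj₂ (inj₁ (_ , eq))) (inj₂ (inj₂ (_ , eq′))) =
  ⊥-elim (head-≢-values w eq′ eq)
at-injective (w ▹₂) (inj₂ (inj₂ (_ , eq′))) (inj₂ (inj₁ (_ , eq))) =
  ⊥-elim (head-≢-values w eq′ eq)
at-injective (w ▹₃) (inj₁ a) (inj₁ a′) = at-injective w a a′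
at-injective (w ▹₃) (inj₁ a) (inj₂ (_ , eq)) = ⊥-elim (<⇒≢ (value-< w a) eq)
at-injective (w ▹₃) (inj₂ (_ , eq)) (inj₁ a) = ⊥-elim (<⇒≢ (value-< w a) eq)
at-injective (w ▹₃) (inj₂ (refl , _)) (inj₂ (refl , _)) = refl

valueAt : (w : Ballot x y z) → i < positions w → ∃[ v ] At w i v
valueAt (w ▹₁) i<p = valueAt w i<p
valueAt (w ▹₂) i<p with m<1+n⇒m<n∨m≡n i<p
... | inj₂ refl = _ , inj₂ (inj₂ (refl , refl))
... | inj₁ i<p′ with m<1+n⇒m<n∨m≡n i<p′
...   | inj₂ refl = _ , inj₂ (inj₁ (refl , refl))
...   | inj₁ i<p″ with valueAt w i<p″
...     | v , a = v , inj₁ a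
valueAt (w ▹₃) i<p with m<1+n⇒m<n∨m≡n i<p
... | inj₂ refl = _ , inj₂ (refl , refl)
... | inj₁ i<p′ with valueAt w i<p′
...   | v , a = v , inj₁ a

-- For a complete word the stack is empty, and this provides the inverse of the permutation.
positionOf : (w : Ballot x y z) → v < values w → v ∈ᵥ pending w ⊎ ∃[ i ] At w i v
positionOf (w ▹₁) v<n with m<1+n⇒m<n∨m≡n v<n
... | inj₂ refl = inj₁ (here refl)
... | inj₁ v<n′ with positionOf w v<n′
...   | inj₁ m = inj₁ (there m)
...   | inj₂ a = inj₂ a
positionOf (w ▹₂) v<n with m<1+n⇒m<n∨m≡n v<n
... | inj₂ refl = inj₂ (_ , inj₂ (inj₁ (refl , refl)))
... | inj₁ v<n′ with positionOf w v<n′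
...   | inj₂ (i , a) = inj₂ (i , inj₁ a)
...   | inj₁ m with ∈-uncons (pending w) m
...     | inj₁ eq = inj₂ (_ , inj₂ (inj₂ (refl , eq)))
...     | inj₂ m′ = inj₁ m′
positionOf (w ▹₃) v<n with m<1+n⇒m<n∨m≡n v<n
... | inj₂ refl = inj₂ (_ , inj₂ (refl , refl))
... | inj₁ v<n′ with positionOf w v<n′
...   | inj₁ m = inj₁ m
...   | inj₂ (i , a) = inj₂ (i , inj₁ a)

-- Descents of the output and avoidance of 312.

top-descent : (w : Ballot x y z) → Top w i →
              ∃₂ λ v u → At w i v × At w (suc i) u × u < v
top-descent (w ▹₁) t = top-descent w t
top-descent (w ▹₂) (inj₁ t) with top-descent w t
... | v , u , a , b , u<v = v , u , inj₁ a , inj₁ b , u<v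
top-descent (w ▹₂) (inj₂ refl) =
  _ , _ , inj₂ (inj₁ (refl , refl)) , inj₂ (inj₂ (refl , refl)) ,
  pending-< w (head-∈ (pending w))
top-descent (w ▹₃) t with top-descent w t
... | v , u , a , b , u<v = v , u , inj₁ a , inj₁ b , u<v

top-< : (w : Ballot x y z) → Top w i → suc i < positions w
top-< w t with top-descent w t
... | _ , _ , _ , b , _ = position-< w b

-- A current value exceeds all values written before it, so only a popped value can lie below its
-- left neighbour, and that neighbour was written by the same letter 2.
descent-top : (w : Ballot x y z) → At w i v → At w (suc i) u → u < v → Top w i
descent-top (w ▹₁) a b u<v = descent-top w a b u<v
descent-top (w ▹₂) a (inj₁ b) u<v =
  inj₁ (descent-top w (at-old₂ w (<-trans (n<1+n _) (position-< w b)) a) b u<v)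
descent-top (w ▹₂) (inj₁ a) (inj₂ (inj₁ (_ , refl))) u<v = ⊥-elim (<-asym u<v (value-< w a))
descent-top (w ▹₂) (inj₂ (inj₁ (refl , _))) (inj₂ (inj₁ (eq , _))) u<v = ⊥-elim (1+n≢n eq)
descent-top (w ▹₂) (inj₂ (inj₂ (refl , _))) (inj₂ (inj₁ (eq , _))) u<v = ⊥-elim (<⇒≢ (m≤n+m _ 1) (sym eq))
descent-top (w ▹₂) a (inj₂ (inj₂ (eq , _))) u<v = inj₂ (suc-injective eq)
descent-top (w ▹₃) a (inj₁ b) u<v =
  descent-top w (at-old₃ w (<-trans (n<1+n _) (position-< w b)) a) b u<v
descent-top (w ▹₃) (inj₁ a) (inj₂ (_ , refl)) u<v = ⊥-elim (<-asym u<v (value-< w a))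
descent-top (w ▹₃) (inj₂ (refl , _)) (inj₂ (eq , _)) u<v = ⊥-elim (1+n≢n eq)

-- Strengthens `at-avoids` for the induction: a pending `t` will be written later and must not
-- complete a pattern then. When `t` is pushed it exceeds all written values; when `v` is written it
-- exceeds all values that remain pending.
pending-avoids : (w : Ballot x y z) → At w i u → At w j v → i < j →
                 t ∈ᵥ pending w → v < t → ¬ t < u
pending-avoids (w ▹₁) a b i<j (here refl) v<t t<u = <-asym t<u (value-< w a)
pending-avoids (w ▹₁) a b i<j (there m) v<t t<u = pending-avoids w a b i<j m v<t t<u
pending-avoids (w ▹₂) a (inj₁ b) i<j m v<t t<u =
  pending-avoids w (at-old₂ w (<-trans i<j (position-< w b)) a) b i<j
    (∈-tail (pending w) m) v<t t<u
pending-avoids (w ▹₂) a (inj₂ (inj₁ (_ , refl))) i<j m v<t t<u =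
  <-asym v<t (pending-< w (∈-tail (pending w) m))
pending-avoids (w ▹₂) a (inj₂ (inj₂ (_ , refl))) i<j m v<t t<u =
  <-asym v<t (tail<head (pending w) (pending-descending w) m)
pending-avoids (w ▹₃) a (inj₁ b) i<j m v<t t<u =
  pending-avoids w (at-old₃ w (<-trans i<j (position-< w b)) a) b i<j m v<t t<u
pending-avoids (w ▹₃) a (inj₂ (_ , refl)) i<j m v<t t<u = <-asym v<t (pending-< w m)

-- Consider the moment when `t` is written. As a current value it is larger than everything to its
-- left; as a popped value it was pending just before, which leaves the case of `pending-avoids` and
-- the case that `v` is the current value.
at-avoids : (w : Ballot x y z) → At w i u → At w j v → At w l t → i < j → j < l →
            v < t → ¬ t < u
at-avoids (w ▹₁) a b c i<j j<l v<t t<u = at-avoids w a b c i<j j<l v<t t<u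
at-avoids (w ▹₂) a b (inj₁ c) i<j j<l v<t t<u =
  at-avoids w (at-old₂ w (<-trans i<j j<p) a) (at-old₂ w j<p b) c i<j j<l v<t t<u
  where j<p = <-trans j<l (position-< w c)
at-avoids (w ▹₂) a b (inj₂ (inj₁ (_ , refl))) i<j j<l v<t t<u =
  <⇒≱ t<u (≤-pred (value-< (w ▹₂) a))
at-avoids (w ▹₂) a (inj₁ b) (inj₂ (inj₂ (refl , refl))) i<j j<l v<t t<u =
  pending-avoids w (at-old₂ w (<-trans i<j (position-< w b)) a) b i<j
    (head-∈ (pending w)) v<t t<u
at-avoids (w ▹₂) a (inj₂ (inj₁ (_ , refl))) (inj₂ (inj₂ (_ , refl))) i<j j<l v<t t<u =
  <-asym v<t (pending-< w (head-∈ (pending w)))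
at-avoids (w ▹₂) a (inj₂ (inj₂ (refl , _))) (inj₂ (inj₂ (refl , _))) i<j j<l v<t t<u =
  n≮n _ j<l
at-avoids (w ▹₃) a b (inj₁ c) i<j j<l v<t t<u =
  at-avoids w (at-old₃ w (<-trans i<j j<p) a) (at-old₃ w j<p b) c i<j j<l v<t t<u
  where j<p = <-trans j<l (position-< w c)
at-avoids (w ▹₃) a b (inj₂ (_ , refl)) i<j j<l v<t t<u =
  <⇒≱ t<u (≤-pred (value-< (w ▹₃) a))

-- Hooks of the output.

unmatched-top : (w : Ballot x y z) → i ∈ᵥ unmatched w → Top w i
unmatched-top (w ▹₁) m           = unmatched-top w m
unmatched-top (w ▹₂) (here refl) = inj₂ refl
unmatched-top (w ▹₂) (there m)   = inj₁ (unmatched-top w m)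
unmatched-top (w ▹₃) m           = unmatched-top w (∈-tail (unmatched w) m)

hook-top : (w : Ballot x y z) → Hook w i j → Top w i
hook-top (w ▹₁) h                 = hook-top w h
hook-top (w ▹₂) h                 = inj₁ (hook-top w h)
hook-top (w ▹₃) (inj₁ h)          = hook-top w h
hook-top (w ▹₃) (inj₂ (refl , _)) = unmatched-top w (head-∈ (unmatched w))

top-hook : (w : Ballot x y z) → Top w i → i ∈ᵥ unmatched w ⊎ ∃[ j ] Hook w i j
top-hook (w ▹₁) t = top-hook w t
top-hook (w ▹₂) (inj₂ refl) = inj₁ (here refl)
top-hook (w ▹₂) (inj₁ t) with top-hook w t
... | inj₁ m = inj₁ (there m)
... | inj₂ h = inj₂ h
top-hook (w ▹₃) t with top-hook w t
... | inj₂ (j , h) = inj₂ (j , inj₁ h)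
... | inj₁ m with ∈-uncons (unmatched w) m
...   | inj₁ eq = inj₂ (_ , inj₂ (eq , refl))
...   | inj₂ m′ = inj₁ m′

hook-< : (w : Ballot x y z) → Hook w i j → i < j × j < positions w
hook-< (w ▹₁) h = hook-< w h
hook-< (w ▹₂) h with hook-< w h
... | p , q = p , m<n⇒m<1+n (m<n⇒m<1+n q)
hook-< (w ▹₃) (inj₁ h) with hook-< w h
... | p , q = p , m<n⇒m<1+n q
hook-< (w ▹₃) (inj₂ (refl , refl)) = unmatched-< w (head-∈ (unmatched w)) , ≤-refl

sw<ne : (w : Ballot x y z) → Hook w i j → i < j
sw<ne w h = proj₁ (hook-< w h)

ne-< : (w : Ballot x y z) → Hook w i j → j < positions w
ne-< w h = proj₂ (hook-< w h)

-- The two kinds of points are written by different letters. Consequently no hook starts where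
-- another one ends.
hook-¬top : (w : Ballot x y z) → Hook w i j → ¬ Top w j
hook-¬top (w ▹₁) h t                 = hook-¬top w h t
hook-¬top (w ▹₂) h (inj₁ t)          = hook-¬top w h t
hook-¬top (w ▹₂) h (inj₂ refl)       = n≮n _ (ne-< w h)
hook-¬top (w ▹₃) (inj₁ h) t          = hook-¬top w h t
hook-¬top (w ▹₃) (inj₂ (_ , refl)) t = 1+n≰n (<⇒≤ (top-< w t))

hook-max : (w : Ballot x y z) → Hook w i j → l < j → At w l u → At w j v → u < v
hook-max (w ▹₁) h l<j a b = hook-max w h l<j a b
hook-max (w ▹₂) h l<j a b =
  hook-max w h l<j (at-old₂ w (<-trans l<j (ne-< w h)) a) (at-old₂ w (ne-< w h) b)
hook-max (w ▹₃) (inj₁ h) l<j a b =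
  hook-max w h l<j (at-old₃ w (<-trans l<j (ne-< w h)) a) (at-old₃ w (ne-< w h) b)
hook-max (w ▹₃) (inj₂ (_ , refl)) l<j a (inj₁ b) = ⊥-elim (n≮n _ (position-< w b))
hook-max (w ▹₃) (inj₂ (_ , refl)) l<j a (inj₂ (_ , refl)) = value-< w (at-old₃ w l<j a)

hook-∉-unmatched : (w : Ballot x y z) → Hook w i j → ¬ i ∈ᵥ unmatched w
hook-∉-unmatched (w ▹₁) h m = hook-∉-unmatched w h m
hook-∉-unmatched (w ▹₂) h (here refl) = n≮n _ (<-trans (sw<ne w h) (ne-< w h))
hook-∉-unmatched (w ▹₂) h (there m) = hook-∉-unmatched w h m
hook-∉-unmatched (w ▹₃) (inj₁ h) m = hook-∉-unmatched w h (∈-tail (unmatched w) m)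
hook-∉-unmatched (w ▹₃) (inj₂ (refl , _)) m =
  n≮n _ (tail<head (unmatched w) (unmatched-descending w) m)

hook-functional : (w : Ballot x y z) → Hook w i j → Hook w i j′ → j ≡ j′
hook-functional (w ▹₁) h h′ = hook-functional w h h′
hook-functional (w ▹₂) h h′ = hook-functional w h h′
hook-functional (w ▹₃) (inj₁ h) (inj₁ h′) = hook-functional w h h′
hook-functional (w ▹₃) (inj₁ h) (inj₂ (refl , _)) =
  ⊥-elim (hook-∉-unmatched w h (head-∈ (unmatched w)))
hook-functional (w ▹₃) (inj₂ (refl , _)) (inj₁ h) =
  ⊥-elim (hook-∉-unmatched w h (head-∈ (unmatched w)))
hook-functional (w ▹₃) (inj₂ (_ , refl)) (inj₂ (_ , refl)) = refl

-- Hooks are closed last in, first out: a start `s` opened after `i` would have been above `i` on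
-- the stack when `i` was popped.
unmatched-outside : (w : Ballot x y z) → Hook w i j → s ∈ᵥ unmatched w → i < s → ¬ s < j
unmatched-outside (w ▹₁) h m i<s s<j = unmatched-outside w h m i<s s<j
unmatched-outside (w ▹₂) h (here refl) i<s s<j = <-asym s<j (ne-< w h)
unmatched-outside (w ▹₂) h (there m) i<s s<j = unmatched-outside w h m i<s s<j
unmatched-outside (w ▹₃) (inj₁ h) m i<s s<j =
  unmatched-outside w h (∈-tail (unmatched w) m) i<s s<j
unmatched-outside (w ▹₃) (inj₂ (refl , _)) m i<s s<j =
  <-asym i<s (tail<head (unmatched w) (unmatched-descending w) m)

hook-nested : (w : Ballot x y z) → Hook w i j → Hook w i′ j′ → i < i′ → i′ < j → j′ < j
hook-nested (w ▹₁) h h′ i<i′ i′<j = hook-nested w h h′ i<i′ i′<j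
hook-nested (w ▹₂) h h′ i<i′ i′<j = hook-nested w h h′ i<i′ i′<j
hook-nested (w ▹₃) (inj₁ h) (inj₁ h′) i<i′ i′<j = hook-nested w h h′ i<i′ i′<j
hook-nested (w ▹₃) (inj₁ h) (inj₂ (refl , refl)) i<i′ i′<j =
  ⊥-elim (unmatched-outside w h (head-∈ (unmatched w)) i<i′ i′<j)
hook-nested (w ▹₃) (inj₂ (refl , refl)) (inj₁ h′) i<i′ i′<j = ne-< w h′
hook-nested (w ▹₃) (inj₂ (refl , refl)) (inj₂ (refl , refl)) i<i′ i′<j = ⊥-elim (n≮n _ i<i′)

covered : (w : Ballot x y z) → i < positions w →
          Top w i ⊎ (∃[ j ] Hook w j i) ⊎ (∃[ j ] i ≡ suc j × Top w j)
covered (w ▹₁) i<p = covered w i<p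
covered (w ▹₂) i<p with m<1+n⇒m<n∨m≡n i<p
... | inj₂ refl = inj₂ (inj₂ (_ , refl , inj₂ refl))
... | inj₁ i<p′ with m<1+n⇒m<n∨m≡n i<p′
...   | inj₂ refl = inj₁ (inj₂ refl)
...   | inj₁ i<p″ with covered w i<p″
...     | inj₁ t                     = inj₁ (inj₁ t)
...     | inj₂ (inj₁ h)              = inj₂ (inj₁ h)
...     | inj₂ (inj₂ (j , eq , t))   = inj₂ (inj₂ (j , eq , inj₁ t))
covered (w ▹₃) i<p with m<1+n⇒m<n∨m≡n i<p
... | inj₂ refl = inj₂ (inj₁ (_ , inj₂ (refl , refl)))
... | inj₁ i<p′ with covered w i<p′
...   | inj₁ t              = inj₁ t
...   | inj₂ (inj₁ (j , h)) = inj₂ (inj₁ (j , inj₁ h))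
...   | inj₂ (inj₂ b)       = inj₂ (inj₂ b)

-- Words are recovered from their output by comparing the positions of the largest value.

data Letter : Set where
  ₁ ₂ ₃ : Letter

-- Erases the indices: two prefixes under comparison need not have the same excesses, so they cannot
-- be equated directly.
letters : Ballot x y z → List Letter
letters ε      = List.[]
letters (w ▹₁) = ₁ List.∷ letters w
letters (w ▹₂) = ₂ List.∷ letters w
letters (w ▹₃) = ₃ List.∷ letters w

letters-injective : (w w′ : Ballot x y z) → letters w ≡ letters w′ → w ≡ w′
letters-injective ε ε eq = refl
letters-injective (w ▹₁) (w′ ▹₁) eq = cong _▹₁ (letters-injective w w′ (∷-injectiveʳ eq))
letters-injective (w ▹₂) (w′ ▹₂) eq = cong _▹₂ (letters-injective w w′ (∷-injectiveʳ eq))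
letters-injective (w ▹₃) (w′ ▹₃) eq = cong _▹₃ (letters-injective w w′ (∷-injectiveʳ eq))

infix 4 _⊑_
_⊑_ : Ballot x y z → Ballot x′ y′ z′ → Set
w ⊑ w′ = ∀ {i v} → At w i v → At w′ i v

at-unstep₂ : (w : Ballot (suc x) y z) (w′ : Ballot (suc x′) y′ z′) →
             positions w ≡ positions w′ → w ▹₂ ⊑ w′ ▹₂ → w ⊑ w′
at-unstep₂ w w′ eq w⊑w′ a = at-old₂ w′ (subst (_ <_) eq (position-< w a)) (w⊑w′ (inj₁ a))

at-unstep₃ : (w : Ballot x (suc y) z) (w′ : Ballot x′ (suc y′) z′) →
             positions w ≡ positions w′ → w ▹₃ ⊑ w′ ▹₃ → w ⊑ w′
at-unstep₃ w w′ eq w⊑w′ a = at-old₃ w′ (subst (_ <_) eq (position-< w a)) (w⊑w′ (inj₁ a))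

last-value₂ : (w : Ballot (suc x) y z) → At (w ▹₂) i v → v ≡ values w → i ≡ positions w
last-value₂ w a refl = at-injective (w ▹₂) a (inj₂ (inj₁ (refl , refl)))

last-value₃ : (w : Ballot x (suc y) z) → At (w ▹₃) i v → v ≡ values w → i ≡ positions w
last-value₃ w a refl = at-injective (w ▹₃) a (inj₂ (refl , refl))

₂⋢₁ : (w : Ballot (suc x) y z) (w′ : Ballot x′ y′ z′) → values w ≡ values w′ →
      ¬ w ▹₂ ⊑ w′ ▹₁
₂⋢₁ w w′ eq le = <⇒≢ (value-< w′ (le (inj₂ (inj₁ (refl , refl))))) eq

₃⋢₁ : (w : Ballot x (suc y) z) (w′ : Ballot x′ y′ z′) → values w ≡ values w′ →
      ¬ w ▹₃ ⊑ w′ ▹₁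
₃⋢₁ w w′ eq le = <⇒≢ (value-< w′ (le (inj₂ (refl , refl)))) eq

-- Letter 2 also fills the position after the largest value, whereas letter 3 leaves the largest
-- value at the end of the output.
₂⋢₃ : (w : Ballot (suc x) y z) (w′ : Ballot x′ (suc y′) z′) → values w ≡ values w′ →
      ¬ w ▹₂ ⊑ w′ ▹₃
₂⋢₃ w w′ eq le = n≮n _ (subst (_< suc (positions w′)) (cong suc p≡p′)
                         (position-< (w′ ▹₃) (le (inj₂ (inj₂ (refl , refl))))))
  where
  p≡p′ : positions w ≡ positions w′
  p≡p′ = last-value₃ w′ (le (inj₂ (inj₁ (refl , refl)))) eq

⊑-letters : (w : Ballot x y z) (w′ : Ballot x′ y′ z′) → values w ≡ values w′ →
            w ⊑ w′ → w′ ⊑ w → letters w ≡ letters w′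
⊑-letters ε      ε       eq le ge = refl
⊑-letters (w ▹₁) (w′ ▹₁) eq le ge = cong (₁ List.∷_) (⊑-letters w w′ (suc-injective eq) le ge)
⊑-letters (w ▹₂) (w′ ▹₂) eq le ge = cong (₂ List.∷_)
  (⊑-letters w w′ (suc-injective eq) (at-unstep₂ w w′ p≡p′ le) (at-unstep₂ w′ w (sym p≡p′) ge))
  where p≡p′ = last-value₂ w′ (le (inj₂ (inj₁ (refl , refl)))) (suc-injective eq)
⊑-letters (w ▹₃) (w′ ▹₃) eq le ge = cong (₃ List.∷_)
  (⊑-letters w w′ (suc-injective eq) (at-unstep₃ w w′ p≡p′ le) (at-unstep₃ w′ w (sym p≡p′) ge))
  where p≡p′ = last-value₃ w′ (le (inj₂ (refl , refl))) (suc-injective eq)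
⊑-letters (w ▹₁) (w′ ▹₂) eq le ge = ⊥-elim (₂⋢₁ w′ w (suc-injective (sym eq)) ge)
⊑-letters (w ▹₁) (w′ ▹₃) eq le ge = ⊥-elim (₃⋢₁ w′ w (suc-injective (sym eq)) ge)
⊑-letters (w ▹₂) (w′ ▹₁) eq le ge = ⊥-elim (₂⋢₁ w w′ (suc-injective eq) le)
⊑-letters (w ▹₂) (w′ ▹₃) eq le ge = ⊥-elim (₂⋢₃ w w′ (suc-injective eq) le)
⊑-letters (w ▹₃) (w′ ▹₁) eq le ge = ⊥-elim (₃⋢₁ w w′ (suc-injective eq) le)
⊑-letters (w ▹₃) (w′ ▹₂) eq le ge = ⊥-elim (₂⋢₃ w′ w (suc-injective (sym eq)) ge)

-- The roles of the points

term≤sum : (f : Fin n → ℕ) → ∀ i → f i ≤ sum f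
term≤sum f zero    = m≤m+n _ _
term≤sum f (suc i) = ≤-trans (term≤sum (f ∘ suc) i) (m≤n+m _ _)

sum-zero : (f : Fin n → ℕ) → (∀ i → f i ≡ 0) → sum f ≡ 0
sum-zero {n} f f≡0 = trans (sum-cong-≗ f≡0) (sum-replicate-zero n)

sum-single : (f : Fin n → ℕ) → ∀ i → (∀ j → j ≢ i → f j ≡ 0) → sum f ≡ f i
sum-single f zero f≡0 =
  trans (cong (f zero +_) (sum-zero (f ∘ suc) λ j → f≡0 (suc j) λ ())) (+-identityʳ _)
sum-single f (suc i) f≡0 =
  trans (cong (_+ sum (f ∘ suc)) (f≡0 zero λ ()))
        (sum-single (f ∘ suc) i λ j j≢i → f≡0 (suc j) (j≢i ∘ Fin.suc-injective))

sum≤1⇒unique : (f : Fin n → ℕ) → sum f ≤ 1 → ∀ i j → 1 ≤ f i → 1 ≤ f j → i ≡ j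
sum≤1⇒unique f s≤1 zero zero p q = refl
sum≤1⇒unique f s≤1 zero (suc j) p q =
  ⊥-elim (1+n≰n (≤-trans (+-mono-≤ p (≤-trans q (term≤sum (f ∘ suc) j))) s≤1))
sum≤1⇒unique f s≤1 (suc i) zero p q =
  ⊥-elim (1+n≰n (≤-trans (+-mono-≤ q (≤-trans p (term≤sum (f ∘ suc) i))) s≤1))
sum≤1⇒unique f s≤1 (suc i) (suc j) p q =
  cong suc (sum≤1⇒unique (f ∘ suc) (≤-trans (m≤n+m _ _) s≤1) i j p q)

n≤sum : (f : Fin n → ℕ) → (∀ i → 1 ≤ f i) → n ≤ sum f
n≤sum {zero}  f 1≤f = z≤n
n≤sum {suc n} f 1≤f = +-mono-≤ (1≤f zero) (n≤sum (f ∘ suc) (1≤f ∘ suc))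

-- Pigeonhole principle: the other terms already contribute `n - 1`.
sum≤n⇒≤1 : (f : Fin n → ℕ) → (∀ i → 1 ≤ f i) → sum f ≤ n → ∀ i → f i ≤ 1
sum≤n⇒≤1 {suc n} f 1≤f s≤n zero =
  +-cancelʳ-≤ n (f zero) 1 (≤-trans (+-monoʳ-≤ (f zero) (n≤sum (f ∘ suc) (1≤f ∘ suc))) s≤n)
sum≤n⇒≤1 {suc n} f 1≤f s≤n (suc i) =
  sum≤n⇒≤1 (f ∘ suc) (1≤f ∘ suc)
    (≤-pred (≤-trans (+-monoˡ-≤ (sum (f ∘ suc)) (1≤f zero)) s≤n)) i

-- Carries the count at a descent top to its descent bottom, one position to the right. The first
-- position is never a descent bottom and gets 0; the last term of `f` is dropped, hence only an
-- inequality below.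
shift : (Fin n → ℕ) → Fin n → ℕ
shift f zero    = 0
shift f (suc i) = f (inject₁ i)

sum-shift-≤ : (f : Fin n → ℕ) → sum (shift f) ≤ sum f
sum-shift-≤ {zero}  f = z≤n
sum-shift-≤ {suc n} f = ≤-trans (m≤m+n _ _) (≤-reflexive (sym (sum-init-last f)))

𝟙 : Bool → ℕ
𝟙 b = if b then 1 else 0

∣p∣≡sum : (p : Subset n) → ∣ p ∣ ≡ ∑[ j < n ] 𝟙 (lookup p j)
∣p∣≡sum []          = refl
∣p∣≡sum (true  ∷ p) = cong suc (∣p∣≡sum p)
∣p∣≡sum (false ∷ p) = ∣p∣≡sum p

sum-map : ∀ {A : Set} (f : A → ℕ) (xs : Vec A n) → Vec.sum (Vec.map f xs) ≡ sum (f ∘ lookup xs)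
sum-map f []       = refl
sum-map f (x ∷ xs) = cong (f x +_) (sum-map f xs)

size≡∑∑ : (H : PairSet n) → size H ≡ ∑[ i < n ] ∑[ j < n ] 𝟙 (lookup (lookup H i) j)
size≡∑∑ H = trans (sum-map ∣_∣ H) (sum-cong-≗ λ i → ∣p∣≡sum (lookup H i))

-- Exposes the normal form of the fraction: on an open term the division by the gcd inside `_/_`
-- does not compute.
coord≡ : (i : Fin n) → coord i ≡ mkℚ (ℤ.+ suc (toℕ i)) 0 (Coprime.sym (Coprime.1-coprimeTo (suc (toℕ i))))
coord≡ i = ℚ.normalize-coprime (Coprime.sym (Coprime.1-coprimeTo (suc (toℕ i))))

coord-mono-≤ : (i j : Fin n) → i Fin.≤ j → coord i ℚ.≤ coord j
coord-mono-≤ i j i≤j rewrite coord≡ i | coord≡ j =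
  *≤* (ℤ.*-monoʳ-≤-nonNeg (ℤ.+ 1) (ℤ.+≤+ (s≤s i≤j)))

coord-cancel-≤ : (i j : Fin n) → coord i ℚ.≤ coord j → i Fin.≤ j
coord-cancel-≤ i j c rewrite coord≡ i | coord≡ j with c
... | *≤* d = ≤-pred (ℤ.drop‿+≤+ (ℤ.*-cancelʳ-≤-pos (ℤ.+ suc (toℕ i)) (ℤ.+ suc (toℕ j)) (ℤ.+ 1) d))

coord-injective : (i j : Fin n) → coord i ≡ coord j → i ≡ j
coord-injective i j eq = Fin.≤-antisym (coord-cancel-≤ i j (ℚ.≤-reflexive eq))
                                       (coord-cancel-≤ j i (ℚ.≤-reflexive (sym eq)))

π-injective : (π : Permutation′ n) → ∀ {i j} → π ⟨$⟩ʳ i ≡ π ⟨$⟩ʳ j → i ≡ j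
π-injective π = Injection.injective (↔⇒↣ π)

predecessor : {i j : Fin n} → i Fin.< j → Σ[ j⁻ ∈ Fin n ] toℕ j ≡ suc (toℕ j⁻)
predecessor {j = suc j} _ = inject₁ j , cong suc (sym (toℕ-inject₁ j))

module Config {n k : ℕ} (n≡3k : n ≡ 3 * k) (C : RedVHC {n} k (Av312 n)) where
  open RedVHC C renaming (perm to π; hooks to H)
  open IsValidHookConfiguration isVHC

  SW NE DB : Fin n → Set
  SW i = ∃[ j ] (i , j) ∈ₚ H
  NE j = ∃[ i ] (i , j) ∈ₚ H
  DB = IsDescentBottom π

  private
    h : Fin n → Fin n → ℕ
    h i j = 𝟙 (lookup (lookup H i) j)

    sw ne : Fin n → ℕ
    sw i = ∑[ j < n ] h i j
    ne j = ∑[ i < n ] h i j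

    1≤h : ∀ {i j} → (i , j) ∈ₚ H → 1 ≤ h i j
    1≤h {i} m = ≤-reflexive (sym (cong 𝟙 ([]=⇒lookup m)))

    1≤sw : ∀ {i} → SW i → 1 ≤ sw i
    1≤sw {i} (j , m) = ≤-trans (1≤h m) (term≤sum (h i) j)

    1≤ne : ∀ {j} → NE j → 1 ≤ ne j
    1≤ne {j} (i , m) = ≤-trans (1≤h m) (term≤sum (λ i → h i j) i)

    1≤shift : (f : Fin n → ℕ) {i j : Fin n} → toℕ j ≡ suc (toℕ i) → 1 ≤ f i → 1 ≤ shift f j
    1≤shift f {i} {suc j} eq p =
      subst (λ i → 1 ≤ f i) (toℕ-injective (trans (suc-injective (sym eq)) (sym (toℕ-inject₁ j)))) p

    1≤db : ∀ {i} → DB i → 1 ≤ shift sw i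
    1≤db (j , eq , gt) = 1≤shift sw eq (1≤sw (Equivalence.from (swEndpoints j) (_ , eq , gt)))

    -- Counts roles with multiplicity. A descent bottom is detected by a hook leaving its left
    -- neighbour, which `swEndpoints` provides, so all three summands are sums of matrix entries
    -- with totals at most `k`.
    kinds : Fin n → ℕ
    kinds i = sw i + (ne i + shift sw i)

    1≤kinds : ∀ i → 1 ≤ kinds i
    1≤kinds i with reduced i
    ... | inj₁ s        = ≤-trans (1≤sw s) (m≤m+n _ _)
    ... | inj₂ (inj₁ e) = ≤-trans (1≤ne e) (≤-trans (m≤m+n _ _) (m≤n+m _ (sw i)))
    ... | inj₂ (inj₂ d) = ≤-trans (1≤db d) (≤-trans (m≤n+m _ (ne i)) (m≤n+m _ (sw i)))

    sum-sw : sum sw ≡ k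
    sum-sw = trans (sym (size≡∑∑ H)) size≡k

    sum-ne : sum ne ≡ k
    sum-ne = trans (sym (∑-comm h)) sum-sw

    sum-kinds-≤ : sum kinds ≤ n
    sum-kinds-≤ = begin
      sum kinds                           ≡⟨ ∑-distrib-+ sw (λ i → ne i + shift sw i) ⟩
      sum sw + sum (λ i → ne i + shift sw i) ≡⟨ cong (sum sw +_) (∑-distrib-+ ne (shift sw)) ⟩
      sum sw + (sum ne + sum (shift sw))  ≤⟨ +-monoʳ-≤ (sum sw) (+-monoʳ-≤ (sum ne) (sum-shift-≤ sw)) ⟩
      sum sw + (sum ne + sum sw)          ≡⟨ cong₂ _+_ sum-sw (cong₂ _+_ sum-ne (trans sum-sw (sym (+-identityʳ k)))) ⟩
      3 * k                               ≡⟨ n≡3k ⟨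
      n                                   ∎
      where open ≤-Reasoning

    kinds≤1 : ∀ i → kinds i ≤ 1
    kinds≤1 = sum≤n⇒≤1 kinds 1≤kinds sum-kinds-≤

    not-two : ∀ {a b c} → 1 ≤ a → 1 ≤ b → a + b ≤ c → ¬ c ≤ 1
    not-two p q r s = 1+n≰n (≤-trans (+-mono-≤ p q) (≤-trans r s))

  row-unique : ∀ {i j j′} → (i , j) ∈ₚ H → (i , j′) ∈ₚ H → j ≡ j′
  row-unique {i} m m′ =
    sum≤1⇒unique (h i) (≤-trans (m≤m+n _ _) (kinds≤1 i)) _ _ (1≤h m) (1≤h m′)

  column-unique : ∀ {i i′ j} → (i , j) ∈ₚ H → (i′ , j) ∈ₚ H → i ≡ i′
  column-unique {j = j} m m′ =
    sum≤1⇒unique (λ i → h i j) (≤-trans (m≤m+n _ _) (≤-trans (m≤n+m _ (sw j)) (kinds≤1 j)))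
      _ _ (1≤h m) (1≤h m′)

  sw-¬ne : ∀ {i} → SW i → ¬ NE i
  sw-¬ne {i} s e = not-two (1≤sw s) (1≤ne e) (+-monoʳ-≤ (sw i) (m≤m+n _ _)) (kinds≤1 i)

  sw-¬db : ∀ {i} → SW i → ¬ DB i
  sw-¬db {i} s d = not-two (1≤sw s) (1≤db d) (+-monoʳ-≤ (sw i) (m≤n+m _ (ne i))) (kinds≤1 i)

  ne-¬db : ∀ {i} → NE i → ¬ DB i
  ne-¬db {i} e d = not-two (1≤ne e) (1≤db d) (m≤n+m _ (sw i)) (kinds≤1 i)

  -- Otherwise i, the predecessor of j and j form a 312-pattern, as j is no descent bottom.
  ¬db-max : ∀ {i j} → ¬ DB j → i Fin.< j → π ⟨$⟩ʳ i Fin.< π ⟨$⟩ʳ j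
  ¬db-max {i} {j} ¬db i<j with Fin.<-cmp (π ⟨$⟩ʳ i) (π ⟨$⟩ʳ j)
  ... | tri< lt _ _ = lt
  ... | tri≈ _ eq _ = ⊥-elim (Fin.<-irrefl (π-injective π eq) i<j)
  ... | tri> _ _ gt with predecessor i<j
  ...   | j⁻ , j≡ with Fin.<-cmp (π ⟨$⟩ʳ j⁻) (π ⟨$⟩ʳ j)
  ...     | tri> _ _ gt′ = ⊥-elim (¬db (j⁻ , j≡ , gt′))
  ...     | tri≈ _ eq _  = ⊥-elim (1+n≢n (sym (trans (cong toℕ (π-injective π eq)) j≡)))
  ...     | tri< lt _ _ with m<1+n⇒m<n∨m≡n {toℕ i} {toℕ j⁻} (subst (toℕ i <_) j≡ i<j)
  ...       | inj₁ i<j⁻ =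
    ⊥-elim (perm∈S (i , j⁻ , j , i<j⁻ , ≤-reflexive (sym j≡) , lt , gt))
  ...       | inj₂ i≡j⁻ =
    ⊥-elim (Fin.<-asym gt (subst (λ l → π ⟨$⟩ʳ l Fin.< π ⟨$⟩ʳ j) (sym (toℕ-injective i≡j⁻)) lt))

  not-above : ∀ {i j l} → (i , j) ∈ₚ H → i Fin.< l → l Fin.< j → π ⟨$⟩ʳ l Fin.< π ⟨$⟩ʳ j
  not-above {i} {j} {l} m i<l l<j with Fin.<-cmp (π ⟨$⟩ʳ l) (π ⟨$⟩ʳ j)
  ... | tri< lt _ _ = lt
  ... | tri≈ _ eq _ = ⊥-elim (Fin.<-irrefl (π-injective π eq) l<j)
  ... | tri> _ _ gt = ⊥-elim (noPointAbove i j m (l , i<l , l<j , gt))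

  -- Otherwise the horizontal arm of the first hook meets the vertical arm of the second at abscissa
  -- `i′`. This lies strictly between `i` and `j`, so the common point is no endpoint of the first
  -- hook.
  noncrossing : ∀ {i j i′ j′} → (i , j) ∈ₚ H → (i′ , j′) ∈ₚ H → i Fin.< i′ → i′ Fin.< j → ¬ j Fin.< j′
  noncrossing {i} {j} {i′} {j′} m m′ i<i′ i′<j j<j′ =
    [ (λ eq → Fin.<-irrefl (sym (coord-injective i′ i (cong proj₁ eq))) i<i′)
    , (λ eq → Fin.<-irrefl (coord-injective i′ j (cong proj₁ eq)) i′<j) ]′
    (proj₁ (noIntersection (i , j) (i′ , j′) m m′
      (λ eq → Fin.<-irrefl (cong proj₁ eq) i<i′)
      (coord i′ , coord (π ⟨$⟩ʳ j))
      (inj₂ (coord-mono-≤ i i′ (<⇒≤ i<i′) , coord-mono-≤ i′ j (<⇒≤ i′<j) , refl))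
      -- Both heights come from `not-above`: the first hook passes over `i′`, the second one over
      -- `j`.
      (inj₁ (refl , coord-mono-≤ (π ⟨$⟩ʳ i′) (π ⟨$⟩ʳ j) (<⇒≤ (not-above m i<i′ i′<j))
                  , coord-mono-≤ (π ⟨$⟩ʳ j) (π ⟨$⟩ʳ j′) (<⇒≤ (not-above m′ i′<j j<j′))))))

-- The configuration of a ballot word

-- An open hook accounts for its SW endpoint and its descent bottom, a closed one for its NE
-- endpoint as well.
positions≡ : (w : Ballot x y z) → positions w ≡ 2 * y + 3 * z
positions≡ ε = refl
positions≡ (w ▹₁) = positions≡ w
positions≡ (_▹₂ {x} {y} {z} w) = trans (cong (2 +_) (positions≡ w)) (e y z)
  where e : ∀ y z → 2 + (2 * y + 3 * z) ≡ 2 * suc y + 3 * z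
        e = solve-∀
positions≡ (_▹₃ {x} {y} {z} w) = trans (cong suc (positions≡ w)) (e y z)
  where e : ∀ y z → suc (2 * suc y + 3 * z) ≡ 2 * y + 3 * suc z
        e = solve-∀

values≡ : (w : Ballot x y z) → values w ≡ x + positions w
values≡ ε = refl
values≡ (w ▹₁) = cong suc (values≡ w)
values≡ (_▹₂ {x} w) = trans (cong suc (values≡ w)) (e x (positions w))
  where e : ∀ x p → suc (suc x + p) ≡ x + (2 + p)
        e = solve-∀
values≡ (_▹₃ {x} w) = trans (cong suc (values≡ w)) (sym (+-suc x (positions w)))

𝟙-true : ∀ {A : Set} (a? : Dec A) → A → 𝟙 (does a?) ≡ 1
𝟙-true a? a = cong 𝟙 (dec-true a? a)

𝟙-false : ∀ {A : Set} (a? : Dec A) → ¬ A → 𝟙 (does a?) ≡ 0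
𝟙-false a? ¬a = cong 𝟙 (dec-false a? ¬a)

𝟙-⊎ : ∀ {A B : Set} (a? : Dec A) (b? : Dec B) → (A → ¬ B) →
      𝟙 (does (a? ⊎-dec b?)) ≡ 𝟙 (does a?) + 𝟙 (does b?)
𝟙-⊎ (yes a) (yes b) ¬ab = ⊥-elim (¬ab a b)
𝟙-⊎ (yes a) (no ¬b) ¬ab = refl
𝟙-⊎ (no ¬a) b?      ¬ab = refl

∑∑-point : ∀ {a b} → a < n → b < n →
           ∑[ i < n ] ∑[ j < n ] 𝟙 (does ((toℕ i ≟ a) ×-dec (toℕ j ≟ b))) ≡ 1
∑∑-point {n} {a} {b} a<n b<n =
  trans (sum-single _ (fromℕ< a<n) λ i i≢ → sum-zero _ λ j →
           𝟙-false (at? i j) (i≢ ∘ as-fromℕ< a<n ∘ proj₁))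
 (trans (sum-single _ (fromℕ< b<n) λ j j≢ →
           𝟙-false (at? (fromℕ< a<n) j) (j≢ ∘ as-fromℕ< b<n ∘ proj₂))
        (𝟙-true (at? (fromℕ< a<n) (fromℕ< b<n)) (toℕ-fromℕ< a<n , toℕ-fromℕ< b<n)))
  where
  at? : ∀ (i j : Fin n) → Dec (toℕ i ≡ a × toℕ j ≡ b)
  at? i j = (toℕ i ≟ a) ×-dec (toℕ j ≟ b)
  as-fromℕ< : ∀ {c} (c<n : c < n) {i : Fin n} → toℕ i ≡ c → i ≡ fromℕ< c<n
  as-fromℕ< c<n eq = toℕ-injective (trans eq (sym (toℕ-fromℕ< c<n)))

hook-count : (w : Ballot x y z) → positions w ≤ n →
             ∑[ i < n ] ∑[ j < n ] 𝟙 (does (hook? w (toℕ i) (toℕ j))) ≡ z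
hook-count {n = n} ε p≤n = sum-zero {n} _ λ i → sum-zero {n} _ λ j → refl
hook-count (w ▹₁) p≤n = hook-count w p≤n
hook-count (w ▹₂) p≤n = hook-count w (≤-trans (m≤n+m _ 2) p≤n)
hook-count {n = n} (_▹₃ {z = z} w) p<n = begin
  (∑[ i < n ] ∑[ j < n ] 𝟙 (does (hook? (w ▹₃) (toℕ i) (toℕ j))))
    -- The older hooks end before `positions w`, where the new one ends, so the two indicators are
    -- never both 1.
    ≡⟨ sum-cong-≗ (λ i → sum-cong-≗ λ j → 𝟙-⊎ (old? i j) (new? i j) λ h → <⇒≢ (ne-< w h) ∘ proj₂) ⟩
  (∑[ i < n ] ∑[ j < n ] (𝟙 (does (old? i j)) + 𝟙 (does (new? i j))))
    ≡⟨ sum-cong-≗ (λ i → ∑-distrib-+ (λ j → 𝟙 (does (old? i j))) (λ j → 𝟙 (does (new? i j)))) ⟩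
  (∑[ i < n ] ((∑[ j < n ] 𝟙 (does (old? i j))) + (∑[ j < n ] 𝟙 (does (new? i j)))))
    ≡⟨ ∑-distrib-+ (λ i → ∑[ j < n ] 𝟙 (does (old? i j))) (λ i → ∑[ j < n ] 𝟙 (does (new? i j))) ⟩
  (∑[ i < n ] ∑[ j < n ] 𝟙 (does (old? i j))) + (∑[ i < n ] ∑[ j < n ] 𝟙 (does (new? i j)))
    ≡⟨ cong₂ _+_ (hook-count w (<⇒≤ p<n))
         (∑∑-point (<-trans (unmatched-< w (head-∈ (unmatched w))) p<n) p<n) ⟩
  z + 1
    ≡⟨ +-comm z 1 ⟩
  suc z ∎
  where
  open ≡-Reasoning
  old? : ∀ (i j : Fin n) → Dec (Hook w (toℕ i) (toℕ j))
  old? i j = hook? w (toℕ i) (toℕ j)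
  new? : ∀ (i j : Fin n) → Dec (toℕ i ≡ head (unmatched w) × toℕ j ≡ positions w)
  new? i j = (toℕ i ≟ head (unmatched w)) ×-dec (toℕ j ≟ positions w)

module Build {n k : ℕ} (w : Ballot 0 0 k) (n≡p : n ≡ positions w) where

  private
    n≡v : n ≡ values w
    n≡v = trans n≡p (sym (values≡ w))

    valueAt′ : ∀ (i : Fin n) → Σ[ v ∈ Fin n ] At w (toℕ i) (toℕ v)
    valueAt′ i with valueAt w (subst (toℕ i <_) n≡p (toℕ<n i))
    ... | v , a = fromℕ< v<n , subst (At w (toℕ i)) (sym (toℕ-fromℕ< v<n)) a
      where v<n = subst (v <_) (sym n≡v) (value-< w a)

    positionOf′ : ∀ (v : Fin n) → Σ[ i ∈ Fin n ] At w (toℕ i) (toℕ v)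
    positionOf′ v with positionOf w (subst (toℕ v <_) n≡v (toℕ<n v))
    ... | inj₁ m = ⊥-elim (∉-empty (pending w) m)
    ... | inj₂ (i , a) = fromℕ< i<n , subst (λ i → At w i (toℕ v)) (sym (toℕ-fromℕ< i<n)) a
      where i<n = subst (i <_) (sym n≡p) (position-< w a)

  -- Keeps `π` and `H` from unfolding; from here on they are accessed through `π-at` and the lemmas
  -- about membership and lookup.
  abstract
    π : Permutation′ n
    π = permutation (proj₁ ∘ valueAt′) (proj₁ ∘ positionOf′)
      (λ v → toℕ-injective (at-functional w (proj₂ (valueAt′ (proj₁ (positionOf′ v)))) (proj₂ (positionOf′ v))))
      (λ i → toℕ-injective (at-injective w (proj₂ (positionOf′ (proj₁ (valueAt′ i)))) (proj₂ (valueAt′ i))))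

    π-at : ∀ i → At w (toℕ i) (toℕ (π ⟨$⟩ʳ i))
    π-at i = proj₂ (valueAt′ i)

    H : PairSet n
    H = tabulate λ i → tabulate λ j → does (hook? w (toℕ i) (toℕ j))

    private
      lookup-H : ∀ i j → lookup (lookup H i) j ≡ does (hook? w (toℕ i) (toℕ j))
      lookup-H i j = trans (cong (λ r → lookup r j) (lookup∘tabulate _ i)) (lookup∘tabulate _ j)

    ∈H⇒hook : ∀ {i j} → (i , j) ∈ₚ H → Hook w (toℕ i) (toℕ j)
    ∈H⇒hook {i} {j} m with hook? w (toℕ i) (toℕ j) | trans (sym (lookup-H i j)) ([]=⇒lookup m)
    ... | yes h | _ = h
    ... | no _  | ()

    hook⇒∈H : ∀ {i j} → Hook w (toℕ i) (toℕ j) → (i , j) ∈ₚ H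
    hook⇒∈H {i} {j} h = lookup⇒[]= j (lookup H i) (trans (lookup-H i j) (dec-true (hook? w (toℕ i) (toℕ j)) h))

  private
    π-at′ : ∀ {i l} → toℕ i ≡ l → At w l (toℕ (π ⟨$⟩ʳ i))
    π-at′ {i} refl = π-at i

    descentTop⇒top : ∀ {i} → IsDescentTop π i → Top w (toℕ i)
    descentTop⇒top {i} (i⁺ , eq , gt) = descent-top w (π-at i) (π-at′ eq) gt

    top⇒descent : ∀ {i} → Top w (toℕ i) → ∃[ i⁺ ] DescentAt π i i⁺
    top⇒descent {i} t with top-descent w t
    ... | v , u , a , b , u<v = i⁺ , toℕ-fromℕ< i⁺<n ,
      subst₂ _<_ (at-functional w b (π-at′ (toℕ-fromℕ< i⁺<n))) (at-functional w a (π-at i)) u<v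
      where
      i⁺<n = subst (suc (toℕ i) <_) (sym n≡p) (position-< w b)
      i⁺ = fromℕ< i⁺<n

    top⇒∈H : ∀ {i} → Top w (toℕ i) → ∃[ j ] (i , j) ∈ₚ H
    top⇒∈H {i} t with top-hook w t
    ... | inj₁ m = ⊥-elim (∉-empty (unmatched w) m)
    ... | inj₂ (j , h) = fromℕ< j<n , hook⇒∈H (subst (Hook w (toℕ i)) (sym (toℕ-fromℕ< j<n)) h)
      where j<n = subst (j <_) (sym n≡p) (ne-< w h)

    max : ∀ {i j l} → (i , j) ∈ₚ H → l Fin.< j → π ⟨$⟩ʳ l Fin.< π ⟨$⟩ʳ j
    max {i} {j} {l} m l<j = hook-max w (∈H⇒hook m) l<j (π-at l) (π-at j)

    hook-x-≤ : ∀ {i j x y} → i Fin.< j → OnHook π (i , j) (x , y) → coord i ℚ.≤ x × x ℚ.≤ coord j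
    hook-x-≤ {i} {j} i<j (inj₁ (refl , _)) = ℚ.≤-refl , coord-mono-≤ i j (<⇒≤ i<j)
    hook-x-≤ i<j (inj₂ (p , q , _)) = p , q

    hook-y-≤ : ∀ {i j x y} → OnHook π (i , j) (x , y) → y ℚ.≤ coord (π ⟨$⟩ʳ j)
    hook-y-≤ (inj₁ (_ , _ , q)) = q
    hook-y-≤ (inj₂ (_ , _ , refl)) = ℚ.≤-refl

    -- A common point forces `i′` to be at most `j`, and equality would make `j` both an NE endpoint
    -- and a descent top. Hence the second hook is nested in the first: it lies to the right of the
    -- vertical arm and below the horizontal one.
    disjoint : ∀ {i j i′ j′} → (i , j) ∈ₚ H → (i′ , j′) ∈ₚ H → i Fin.< i′ →
               ∀ p → OnHook π (i , j) p → ¬ OnHook π (i′ , j′) p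
    disjoint {i} {j} {i′} {j′} m m′ i<i′ (x , y) on on′ = go on
      where
      i<j = sw<ne w (∈H⇒hook m)
      i′<j′ = sw<ne w (∈H⇒hook m′)
      i′≤x = proj₁ (hook-x-≤ i′<j′ on′)
      i′≤j : i′ Fin.≤ j
      i′≤j = coord-cancel-≤ i′ j (ℚ.≤-trans i′≤x (proj₂ (hook-x-≤ i<j on)))
      i′<j : i′ Fin.< j
      i′<j = ≤∧≢⇒< i′≤j λ eq → hook-¬top w (∈H⇒hook m) (subst (Top w) eq (hook-top w (∈H⇒hook m′)))
      j′<j : j′ Fin.< j
      j′<j = hook-nested w (∈H⇒hook m) (∈H⇒hook m′) i<i′ i′<j
      go : ¬ OnHook π (i , j) (x , y)
      go (inj₁ (refl , _)) = <⇒≱ i<i′ (coord-cancel-≤ i′ i i′≤x)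
      go (inj₂ (_ , _ , refl)) = <⇒≱ (max m j′<j) (coord-cancel-≤ (π ⟨$⟩ʳ j) (π ⟨$⟩ʳ j′) (hook-y-≤ on′))

  valid : IsValidHookConfiguration π H
  valid = record
    { areHooks = λ (i , j) m → sw<ne w (∈H⇒hook m) , max m (sw<ne w (∈H⇒hook m))
    ; swEndpoints = λ i → mk⇔ (λ (j , m) → top⇒descent (hook-top w (∈H⇒hook m)))
                              (λ d → top⇒∈H (descentTop⇒top d))
    ; noPointAbove = λ i j m (l , _ , l<j , gt) → <-asym (max m l<j) gt
    ; noIntersection = noIntersection′
    }
    where
    noIntersection′ : ∀ h h′ → h ∈ₚ H → h′ ∈ₚ H → ¬ (h ≡ h′) →
                      ∀ p → OnHook π h p → OnHook π h′ p →
                      IsEndpoint π h p × IsEndpoint π h′ p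
    noIntersection′ (i , j) (i′ , j′) m m′ h≢h′ p on on′ = ⊥-elim (cases (Fin.<-cmp i i′))
      where
      cases : ¬ Tri (i Fin.< i′) (i ≡ i′) (i Fin.> i′)
      cases (tri< i<i′ _ _) = disjoint m m′ i<i′ p on on′
      cases (tri> _ _ i′<i) = disjoint m′ m i′<i p on′ on
      cases (tri≈ _ i≡i′ _) = h≢h′ (cong₂ _,_ i≡i′ (toℕ-injective
        (hook-functional w (∈H⇒hook m) (subst (λ i → Hook w (toℕ i) (toℕ j′)) (sym i≡i′) (∈H⇒hook m′)))))

  avoids : Av312 n π
  avoids (a , b , c , a<b , b<c , πb<πc , πc<πa) =
    at-avoids w (π-at a) (π-at b) (π-at c) a<b b<c πb<πc πc<πa

  isReduced : IsReduced π H
  isReduced i with covered w (subst (toℕ i <_) n≡p (toℕ<n i))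
  ... | inj₁ t = inj₁ (top⇒∈H t)
  ... | inj₂ (inj₁ (j , h)) =
    inj₂ (inj₁ (fromℕ< j<n , hook⇒∈H (subst (λ j → Hook w j (toℕ i)) (sym (toℕ-fromℕ< j<n)) h)))
    where j<n = <-trans (sw<ne w h) (toℕ<n i)
  ... | inj₂ (inj₂ (j , eq , t)) with top⇒descent (subst (Top w) (sym (toℕ-fromℕ< j<n)) t)
    where j<n = <-trans (subst (j <_) (sym eq) (n<1+n j)) (toℕ<n i)
  ...   | i⁺ , eq⁺ , gt =
    inj₂ (inj₂ (_ , subst (λ i → DescentAt π _ i)
      (toℕ-injective (trans eq⁺ (trans (cong suc (toℕ-fromℕ< _)) (sym eq)))) (eq⁺ , gt)))

  size-H : size H ≡ k
  size-H = trans (size≡∑∑ H)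
    (trans (sum-cong-≗ λ i → sum-cong-≗ λ j → cong 𝟙 (lookup-H i j))
           (hook-count w (≤-reflexive (sym n≡p))))

  config : RedVHC k (Av312 n)
  config = record
    { perm = π ; perm∈S = avoids ; hooks = H ; isVHC = valid
    ; reduced = isReduced ; size≡k = size-H }


-- The ballot word of a configuration

module Simulation {n k : ℕ} (n≡3k : n ≡ 3 * k) (C : RedVHC {n} k (Av312 n)) where
  open RedVHC C renaming (perm to π; hooks to H)
  open IsValidHookConfiguration isVHC
  open Config n≡3k C

  -- The invariant after the values below `values w` have been read. Pending values belong to
  -- descent bottoms, and the next free position is none, so the machine is never due to write a
  -- pending value first. Each hook that starts in the written part is either recorded or still
  -- open.
  record Simulates (w : Ballot x y z) : Set where
    field
      filled    : ∀ i → toℕ i < positions w → At w (toℕ i) (toℕ (π ⟨$⟩ʳ i))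
      unfilled  : ∀ i → positions w ≤ toℕ i →
                  values w ≤ toℕ (π ⟨$⟩ʳ i) ⊎ toℕ (π ⟨$⟩ʳ i) ∈ᵥ pending w
      pending-db : ∀ {u} → u ∈ᵥ pending w →
                   ∃[ i ] (positions w ≤ toℕ i × toℕ (π ⟨$⟩ʳ i) ≡ u × DB i)
      next-¬db  : ∀ i → toℕ i ≡ positions w → ¬ DB i
      started   : ∀ {i j} → (i , j) ∈ₚ H → toℕ i < positions w →
                  Hook w (toℕ i) (toℕ j) ⊎ (toℕ i ∈ᵥ unmatched w × positions w ≤ toℕ j)
      unmatched-hook : ∀ {s} → s ∈ᵥ unmatched w →
                  ∃₂ λ i j → toℕ i ≡ s × (i , j) ∈ₚ H × positions w ≤ toℕ j

  open Simulates

  -- The excesses are existential because the configuration dictates the letters; that they never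
  -- become negative is part of each step.
  State : ℕ → Set
  State v = ∃[ x ] ∃[ y ] ∃[ z ] Σ[ w ∈ Ballot x y z ] (values w ≡ v × Simulates w)

  module _ (w : Ballot x y z) (sim : Simulates w) {j : Fin n} (πj : toℕ (π ⟨$⟩ʳ j) ≡ values w) where

    new-unfilled : positions w ≤ toℕ j
    new-unfilled = ≮⇒≥ λ j<p → <⇒≢ (value-< w (filled sim j j<p)) πj

    -- The positions between positions w and j carry smaller values that are still
    -- pending, so they are all descent bottoms; the first of them cannot be one.
    ¬db-next : ¬ DB j → toℕ j ≡ positions w
    ¬db-next ¬db with m≤n⇒m<n∨m≡n new-unfilled
    ... | inj₂ eq = sym eq
    ... | inj₁ p<j = ⊥-elim (go (unfilled sim q (≤-reflexive (sym q≡p))))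
      where
      q = fromℕ< (<-trans p<j (toℕ<n j))
      q≡p : toℕ q ≡ positions w
      q≡p = toℕ-fromℕ< (<-trans p<j (toℕ<n j))
      go : ¬ (values w ≤ toℕ (π ⟨$⟩ʳ q) ⊎ toℕ (π ⟨$⟩ʳ q) ∈ᵥ pending w)
      go (inj₁ v≤) = <⇒≱ (¬db-max ¬db (subst (_< toℕ j) (sym q≡p) p<j))
                           (subst (_≤ toℕ (π ⟨$⟩ʳ q)) (sym πj) v≤)
      go (inj₂ m) with pending-db sim m
      ... | i , _ , eq , db = next-¬db sim q q≡p (subst DB (π-injective π (toℕ-injective eq)) db)

    push : DB j → Simulates (w ▹₁)
    push db = record
      { filled = filled sim
      ; unfilled = unfilled′
      ; pending-db = λ { (here refl) → j , new-unfilled , πj , db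
                       ; (there m) → pending-db sim m }
      ; next-¬db = next-¬db sim
      ; started = started sim
      ; unmatched-hook = unmatched-hook sim
      }
      where
      unfilled′ : ∀ i → positions w ≤ toℕ i →
                  suc (values w) ≤ toℕ (π ⟨$⟩ʳ i) ⊎ toℕ (π ⟨$⟩ʳ i) ∈ᵥ pending (w ▹₁)
      unfilled′ i p≤i with unfilled sim i p≤i
      ... | inj₂ m = inj₂ (there m)
      ... | inj₁ v≤ with m≤n⇒m<n∨m≡n v≤
      ...   | inj₁ v< = inj₁ v<
      ...   | inj₂ eq = inj₂ (here (sym eq))

    larger : ∀ {i} → values w ≤ toℕ (π ⟨$⟩ʳ i) → i ≢ j → values w < toℕ (π ⟨$⟩ʳ i)
    larger v≤ i≢j = ≤∧≢⇒< v≤ λ eq → i≢j (π-injective π (toℕ-injective (trans (sym eq) (sym πj))))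

    pending-≢ : ∀ {i} → toℕ (π ⟨$⟩ʳ i) ∈ᵥ pending w → i ≢ j
    pending-≢ m refl = <⇒≢ (pending-< w m) πj

  module _ (w : Ballot (suc x) y z) (sim : Simulates w) {j j⁺ : Fin n}
           (πj : toℕ (π ⟨$⟩ʳ j) ≡ values w) (sw : SW j) (j≡p : toℕ j ≡ positions w)
           (d : DescentAt π j j⁺) (m : toℕ (π ⟨$⟩ʳ j⁺) ∈ᵥ pending w) where

    private
      j⁺≡p : toℕ j⁺ ≡ suc (positions w)
      j⁺≡p = trans (proj₁ d) (cong suc j≡p)

      db⁺ : DB j⁺
      db⁺ = j , d

      beyond : ∀ {i} → positions w ≤ toℕ i → i ≢ j → i ≢ j⁺ → 2 + positions w ≤ toℕ i
      beyond p≤i i≢j i≢j⁺ =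
        ≤∧≢⇒< (≤∧≢⇒< p≤i λ eq → i≢j (toℕ-injective (trans (sym eq) (sym j≡p))))
                λ eq → i≢j⁺ (toℕ-injective (trans (sym eq) (sym j⁺≡p)))

      -- A larger pending value would sit after position j⁺ and create a 312-pattern.
      head≡ : toℕ (π ⟨$⟩ʳ j⁺) ≡ head (pending w)
      head≡ with ∈-uncons (pending w) m
      ... | inj₁ eq = eq
      ... | inj₂ m′ with pending-db sim (head-∈ (pending w))
      ...   | i , p≤i , eq , db = ⊥-elim (perm∈S (j , j⁺ , i ,
                ≤-reflexive (sym (proj₁ d)) ,
                subst (_< toℕ i) (sym j⁺≡p) (beyond p≤i i≢j i≢j⁺) ,
                subst (toℕ (π ⟨$⟩ʳ j⁺) <_) (sym eq) j⁺<head ,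
                subst₂ _<_ (sym eq) (sym πj) (pending-< w (head-∈ (pending w)))))
        where
        j⁺<head = tail<head (pending w) (pending-descending w) m′
        i≢j : i ≢ j
        i≢j = pending-≢ w sim πj (subst (_∈ᵥ pending w) (sym eq) (head-∈ (pending w)))
        i≢j⁺ : i ≢ j⁺
        i≢j⁺ refl = <⇒≢ j⁺<head eq

      filled′ : ∀ i → toℕ i < 2 + positions w → At (w ▹₂) (toℕ i) (toℕ (π ⟨$⟩ʳ i))
      filled′ i i<p with m<1+n⇒m<n∨m≡n i<p
      ... | inj₂ eq = inj₂ (inj₂ (eq , trans (cong (toℕ ∘ (π ⟨$⟩ʳ_)) (toℕ-injective (trans eq (sym j⁺≡p)))) head≡))
      ... | inj₁ i<p′ with m<1+n⇒m<n∨m≡n i<p′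
      ...   | inj₂ eq = inj₂ (inj₁ (eq , trans (cong (toℕ ∘ (π ⟨$⟩ʳ_)) (toℕ-injective (trans eq (sym j≡p)))) πj))
      ...   | inj₁ i<p″ = inj₁ (filled sim i i<p″)

      p≤ : ∀ {i} → 2 + positions w ≤ i → positions w ≤ i
      p≤ = ≤-trans (m≤n+m _ 2)

      unfilled′ : ∀ i → 2 + positions w ≤ toℕ i →
                  suc (values w) ≤ toℕ (π ⟨$⟩ʳ i) ⊎ toℕ (π ⟨$⟩ʳ i) ∈ᵥ pending (w ▹₂)
      unfilled′ i p≤i with unfilled sim i (p≤ p≤i)
      ... | inj₁ v≤ = inj₁ (larger w sim πj v≤ λ { refl → <⇒≢ (≤-trans (m≤n+m _ 1) p≤i) (sym j≡p) })
      ... | inj₂ m′ with ∈-uncons (pending w) m′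
      ...   | inj₂ m″ = inj₂ m″
      ...   | inj₁ eq with π-injective π (toℕ-injective (trans eq (sym head≡)))
      ...     | refl = ⊥-elim (<⇒≢ p≤i (sym j⁺≡p))

      pending-db′ : ∀ {u} → u ∈ᵥ pending (w ▹₂) →
                    ∃[ i ] (2 + positions w ≤ toℕ i × toℕ (π ⟨$⟩ʳ i) ≡ u × DB i)
      pending-db′ m′ with pending-db sim (∈-tail (pending w) m′)
      ... | i , p≤i , refl , db =
        i , beyond p≤i (pending-≢ w sim πj (∈-tail (pending w) m′)) i≢j⁺ , refl , db
        where
        i≢j⁺ : i ≢ j⁺
        i≢j⁺ refl = <⇒≢ (tail<head (pending w) (pending-descending w) m′) head≡

      -- Roles are exclusive: an NE endpoint is neither `j`, an SW endpoint, nor `j⁺`, a descent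
      -- bottom.
      beyond-hook : ∀ {i j₂} → (i , j₂) ∈ₚ H → positions w ≤ toℕ j₂ → 2 + positions w ≤ toℕ j₂
      beyond-hook h p≤ = beyond p≤ (λ { refl → sw-¬ne sw (_ , h) }) (λ { refl → ne-¬db (_ , h) db⁺ })

      started′ : ∀ {i j₂} → (i , j₂) ∈ₚ H → toℕ i < 2 + positions w →
                 Hook (w ▹₂) (toℕ i) (toℕ j₂) ⊎
                 (toℕ i ∈ᵥ unmatched (w ▹₂) × 2 + positions w ≤ toℕ j₂)
      started′ {i} {j₂} h i<p with m<1+n⇒m<n∨m≡n i<p
      ... | inj₂ eq = ⊥-elim (sw-¬db (j₂ , h) (subst DB (toℕ-injective (trans j⁺≡p (sym eq))) db⁺))
      ... | inj₁ i<p′ with m<1+n⇒m<n∨m≡n i<p′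
      ...   | inj₂ eq = inj₂ (here eq ,
                beyond-hook h (subst (_≤ toℕ j₂) eq (<⇒≤ (proj₁ (areHooks _ h)))))
      ...   | inj₁ i<p″ with started sim h i<p″
      ...     | inj₁ hook        = inj₁ hook
      ...     | inj₂ (m′ , p≤j₂) = inj₂ (there m′ , beyond-hook h p≤j₂)

      unmatched-hook′ : ∀ {s} → s ∈ᵥ unmatched (w ▹₂) →
                        ∃₂ λ i j₂ → toℕ i ≡ s × (i , j₂) ∈ₚ H × 2 + positions w ≤ toℕ j₂
      unmatched-hook′ (here refl) = j , proj₁ sw , j≡p , proj₂ sw ,
        beyond-hook (proj₂ sw) (subst (_≤ _) j≡p (<⇒≤ (proj₁ (areHooks _ (proj₂ sw)))))
      unmatched-hook′ (there m′) with unmatched-hook sim m′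
      ... | i , j₂ , eq , h , p≤j₂ = i , j₂ , eq , h , beyond-hook h p≤j₂

      -- The left neighbour is `j⁺`, which would be a descent top in addition to a descent bottom.
      next-¬db′ : ∀ i → toℕ i ≡ 2 + positions w → ¬ DB i
      next-¬db′ i eq (i⁻ , eq⁻ , gt) = sw-¬db (Equivalence.from (swEndpoints i⁻) (i , eq⁻ , gt))
        (subst DB (toℕ-injective (trans j⁺≡p (sym (suc-injective (trans (sym eq⁻) eq))))) db⁺)

    pop : Simulates (w ▹₂)
    pop = record
      { filled = filled′ ; unfilled = unfilled′ ; pending-db = pending-db′
      ; next-¬db = next-¬db′ ; started = started′ ; unmatched-hook = unmatched-hook′ }

  module _ (w : Ballot x (suc y) z) (sim : Simulates w) {i j : Fin n}
           (πj : toℕ (π ⟨$⟩ʳ j) ≡ values w) (h : (i , j) ∈ₚ H) (j≡p : toℕ j ≡ positions w)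
           (m : toℕ i ∈ᵥ unmatched w) where

    private
      -- A later unmatched hook would cross (i , j).
      head≡ : toℕ i ≡ head (unmatched w)
      head≡ with ∈-uncons (unmatched w) m
      ... | inj₁ eq = eq
      ... | inj₂ m′ with unmatched-hook sim (head-∈ (unmatched w))
      ...   | i′ , j′ , eq , h′ , p≤j′ with m≤n⇒m<n∨m≡n p≤j′
      ...     | inj₂ p≡j′ with toℕ-injective (trans j≡p p≡j′)
      ...       | refl = ⊥-elim (<⇒≢ (tail<head (unmatched w) (unmatched-descending w) m′)
                                      (trans (cong toℕ (column-unique h h′)) eq))
      head≡ | inj₂ m′ | i′ , j′ , eq , h′ , p≤j′ | inj₁ p<j′ =
        ⊥-elim (noncrossing h h′
          (subst (toℕ i <_) (sym eq) (tail<head (unmatched w) (unmatched-descending w) m′))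
          (subst₂ _<_ (sym eq) (sym j≡p) (unmatched-< w (head-∈ (unmatched w))))
          (subst (_< toℕ j′) (sym j≡p) p<j′))

      filled′ : ∀ l → toℕ l < suc (positions w) → At (w ▹₃) (toℕ l) (toℕ (π ⟨$⟩ʳ l))
      filled′ l l<p with m<1+n⇒m<n∨m≡n l<p
      ... | inj₁ l<p′ = inj₁ (filled sim l l<p′)
      ... | inj₂ eq = inj₂ (eq , trans (cong (toℕ ∘ (π ⟨$⟩ʳ_)) (toℕ-injective (trans eq (sym j≡p)))) πj)

      beyond : ∀ {l} → positions w ≤ toℕ l → l ≢ j → suc (positions w) ≤ toℕ l
      beyond p≤l l≢j = ≤∧≢⇒< p≤l λ eq → l≢j (toℕ-injective (trans (sym eq) (sym j≡p)))

      unfilled′ : ∀ l → suc (positions w) ≤ toℕ l →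
                  suc (values w) ≤ toℕ (π ⟨$⟩ʳ l) ⊎ toℕ (π ⟨$⟩ʳ l) ∈ᵥ pending w
      unfilled′ l p<l with unfilled sim l (<⇒≤ p<l)
      ... | inj₁ v≤ = inj₁ (larger w sim πj v≤ λ { refl → <⇒≢ p<l (sym j≡p) })
      ... | inj₂ m′ = inj₂ m′

      pending-db′ : ∀ {u} → u ∈ᵥ pending w →
                    ∃[ l ] (suc (positions w) ≤ toℕ l × toℕ (π ⟨$⟩ʳ l) ≡ u × DB l)
      pending-db′ m′ with pending-db sim m′
      ... | l , p≤l , refl , db = l , beyond p≤l (pending-≢ w sim πj m′) , refl , db

      next-¬db′ : ∀ l → toℕ l ≡ suc (positions w) → ¬ DB l
      next-¬db′ l eq (l⁻ , eq⁻ , gt) = sw-¬ne (Equivalence.from (swEndpoints l⁻) (l , eq⁻ , gt))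
        (subst NE (toℕ-injective (trans j≡p (sym (suc-injective (trans (sym eq⁻) eq))))) (i , h))

      started′ : ∀ {i₂ j₂} → (i₂ , j₂) ∈ₚ H → toℕ i₂ < suc (positions w) →
                 Hook (w ▹₃) (toℕ i₂) (toℕ j₂) ⊎
                 (toℕ i₂ ∈ᵥ unmatched (w ▹₃) × suc (positions w) ≤ toℕ j₂)
      started′ {i₂} {j₂} h₂ i₂<p with m<1+n⇒m<n∨m≡n i₂<p
      ... | inj₂ eq = ⊥-elim (sw-¬ne (j₂ , h₂)
              (subst NE (toℕ-injective (trans j≡p (sym eq))) (i , h)))
      ... | inj₁ i₂<p′ with started sim h₂ i₂<p′
      ...   | inj₁ hook = inj₁ (inj₁ hook)
      ...   | inj₂ (m₂ , p≤j₂) with ∈-uncons (unmatched w) m₂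
      -- The popped start is `i`, whose only hook is the one being closed. All other open hooks end
      -- elsewhere by `column-unique`, as shown in the last case.
      ...     | inj₁ eq with toℕ-injective (trans eq (sym head≡))
      ...       | refl = inj₁ (inj₂ (eq , trans (cong toℕ (row-unique h₂ h)) j≡p))
      started′ {i₂} {j₂} h₂ i₂<p | inj₁ i₂<p′ | inj₂ (m₂ , p≤j₂) | inj₂ m₂′ =
        inj₂ (m₂′ , beyond p≤j₂ λ { refl → <⇒≢ (tail<head (unmatched w) (unmatched-descending w) m₂′)
                                            (trans (cong toℕ (column-unique h₂ h)) head≡) })

      unmatched-hook′ : ∀ {s} → s ∈ᵥ unmatched (w ▹₃) →
                        ∃₂ λ i₂ j₂ → toℕ i₂ ≡ s × (i₂ , j₂) ∈ₚ H × suc (positions w) ≤ toℕ j₂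
      unmatched-hook′ m′ with unmatched-hook sim (∈-tail (unmatched w) m′)
      ... | i₂ , j₂ , refl , h₂ , p≤j₂ = i₂ , j₂ , refl , h₂ ,
        beyond p≤j₂ λ { refl → <⇒≢ (tail<head (unmatched w) (unmatched-descending w) m′)
                                     (trans (cong toℕ (column-unique h₂ h)) head≡) }

    close : Simulates (w ▹₃)
    close = record
      { filled = filled′ ; unfilled = unfilled′ ; pending-db = pending-db′
      ; next-¬db = next-¬db′ ; started = started′ ; unmatched-hook = unmatched-hook′ }

  -- The point after `j` is unwritten and lies below the current value, so its value is pending.
  -- This shows that the stack is nonempty and letter 2 is allowed.
  step-sw : (w : Ballot x y z) → Simulates w → ∀ {j} → toℕ (π ⟨$⟩ʳ j) ≡ values w →
            SW j → State (suc (values w))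
  step-sw {x} w sim {j} πj sw with Equivalence.to (swEndpoints j) sw
  ... | j⁺ , d with ¬db-next w sim πj (sw-¬db sw)
  ...   | j≡p with unfilled sim j⁺ (subst₂ _≤_ j≡p (sym (proj₁ d)) (n≤1+n _))
  ...     | inj₁ v≤ = ⊥-elim (<⇒≱ (proj₂ d) (subst (_≤ _) (sym πj) v≤))
  step-sw {zero}  w sim πj sw | j⁺ , d | j≡p | inj₂ m = ⊥-elim (∉-empty (pending w) m)
  step-sw {suc x} w sim πj sw | j⁺ , d | j≡p | inj₂ m =
    _ , _ , _ , w ▹₂ , refl , pop w sim πj sw j≡p d m

  -- The hook ending at `j` starts in the written part, but recorded hooks end there too. Hence it
  -- is still open, and letter 3 is allowed.
  step-ne : (w : Ballot x y z) → Simulates w → ∀ {j} → toℕ (π ⟨$⟩ʳ j) ≡ values w →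
            NE j → State (suc (values w))
  step-ne w sim {j} πj (i , h) with ¬db-next w sim πj (ne-¬db (i , h))
  ... | j≡p with started sim h (subst (toℕ i <_) j≡p (proj₁ (areHooks _ h)))
  ...   | inj₁ hook = ⊥-elim (<⇒≢ (ne-< w hook) j≡p)
  step-ne {y = zero}  w sim πj (i , h) | j≡p | inj₂ (m , _) = ⊥-elim (∉-empty (unmatched w) m)
  step-ne {y = suc y} w sim πj (i , h) | j≡p | inj₂ (m , _) =
    _ , _ , _ , w ▹₃ , refl , close w sim πj h j≡p m

  step : ∀ {v} → v < n → State v → State (suc v)
  step v<n (_ , _ , _ , w , refl , sim) = go (reduced p)
    where
    p = π ⟨$⟩ˡ fromℕ< v<n
    πp : toℕ (π ⟨$⟩ʳ p) ≡ values w
    πp = trans (cong toℕ (inverseʳ π)) (toℕ-fromℕ< v<n)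
    go : SW p ⊎ NE p ⊎ DB p → State (suc (values w))
    go (inj₁ sw)        = step-sw w sim πp sw
    go (inj₂ (inj₁ ne)) = step-ne w sim πp ne
    go (inj₂ (inj₂ db)) = _ , _ , _ , w ▹₁ , refl , push w sim πp db

  simulate : ∀ v → v ≤ n → State v
  simulate zero    _   = _ , _ , _ , ε , refl , record
    { filled = λ _ () ; unfilled = λ _ _ → inj₁ z≤n ; pending-db = λ ()
    ; next-¬db = λ { i i≡0 (_ , eq , _) → 1+n≢0 (trans (sym eq) i≡0) }
    ; started = λ _ () ; unmatched-hook = λ () }
  simulate (suc v) v<n = step v<n (simulate v (<⇒≤ v<n))

  Word : Set
  Word = Σ[ w ∈ Ballot 0 0 k ] ((∀ i → At w (toℕ i) (toℕ (π ⟨$⟩ʳ i))) ×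
                                (∀ {i j} → (i , j) ∈ₚ H → Hook w (toℕ i) (toℕ j)))

  word : Word
  word with simulate n ≤-refl
  ... | x , y , z , w , v≡n , sim = finish w v≡n sim
    where
    -- The first position left over would carry a pending value, as no values from `n` on exist. It
    -- would thus be a descent bottom, contrary to `next-¬db`.
    all-filled : ∀ {x y z} (w : Ballot x y z) → values w ≡ n → Simulates w → n ≤ positions w
    all-filled w refl sim = ≮⇒≥ λ p<n → go p<n (unfilled sim (fromℕ< p<n) (≤-reflexive (sym (toℕ-fromℕ< p<n))))
      where
      go : (p<n : positions w < n) → ¬ (n ≤ toℕ (π ⟨$⟩ʳ fromℕ< p<n) ⊎ toℕ (π ⟨$⟩ʳ fromℕ< p<n) ∈ᵥ pending w)
      go p<n (inj₁ n≤) = <⇒≱ (toℕ<n (π ⟨$⟩ʳ fromℕ< p<n)) n≤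
      go p<n (inj₂ m) with pending-db sim m
      ... | i , _ , eq , db =
        next-¬db sim _ (toℕ-fromℕ< p<n) (subst DB (π-injective π (toℕ-injective eq)) db)
    finish : ∀ {x y z} (w : Ballot x y z) → values w ≡ n → Simulates w → Word
    -- Both stacks are empty, since a leftover entry would require a position at or beyond `n`.
    -- Comparing lengths then yields `z ≡ k`.
    finish {suc x} w v≡n sim with pending-db sim (head-∈ (pending w))
    ... | i , p≤i , _ = ⊥-elim (<⇒≱ (toℕ<n i) (≤-trans (all-filled w v≡n sim) p≤i))
    finish {zero} {suc y} w v≡n sim with unmatched-hook sim (head-∈ (unmatched w))
    ... | _ , j , _ , _ , p≤j = ⊥-elim (<⇒≱ (toℕ<n j) (≤-trans (all-filled w v≡n sim) p≤j))
    finish {zero} {zero} {z} w v≡n sim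
      with *-cancelˡ-≡ z k 3 (trans (sym (positions≡ w)) (trans (sym (values≡ w)) (trans v≡n n≡3k)))
    ... | refl = w , (λ i → filled sim i (i<p i)) , λ {i} h →
      [ (λ hook → hook) , (λ (m , _) → ⊥-elim (∉-empty (unmatched w) m)) ]′ (started sim h (i<p i))
      where
      i<p : ∀ i → toℕ i < positions w
      i<p i = <-≤-trans (toℕ<n i) (all-filled w v≡n sim)

-- The bijection between ballot words and configurations.

config : Ballot 0 0 k → RedVHC k (Av312 (3 * k))
config w = Build.config w (sym (positions≡ w))

perm : Ballot 0 0 k → Permutation′ (3 * k)
perm w = RedVHC.perm (config w)

perm-at : (w : Ballot 0 0 k) → ∀ i → At w (toℕ i) (toℕ (perm w ⟨$⟩ʳ i))
perm-at w = Build.π-at w (sym (positions≡ w))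

perm-⊑ : (w w′ : Ballot 0 0 k) → perm w Perm.≈ perm w′ → w ⊑ w′
perm-⊑ w w′ π≈ {i} {v} a =
  subst₂ (At w′) (toℕ-fromℕ< i<n) v≡ (perm-at w′ (fromℕ< i<n))
  where
  i<n = subst (i <_) (positions≡ w) (position-< w a)
  v≡ : toℕ (perm w′ ⟨$⟩ʳ fromℕ< i<n) ≡ v
  v≡ = trans (cong toℕ (sym (π≈ (fromℕ< i<n))))
    (at-functional w (perm-at w (fromℕ< i<n)) (subst (λ i → At w i v) (sym (toℕ-fromℕ< i<n)) a))

perm-injective : (w w′ : Ballot 0 0 k) → perm w Perm.≈ perm w′ → w ≡ w′
perm-injective w w′ π≈ = letters-injective w w′
  (⊑-letters w w′ values≡values (perm-⊑ w w′ π≈) (perm-⊑ w′ w (sym ∘ π≈)))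
  where
  values≡values : values w ≡ values w′
  values≡values = trans (values≡ w) (trans (trans (positions≡ w) (sym (positions≡ w′))) (sym (values≡ w′)))

module _ (C : RedVHC k (Av312 (3 * k))) where
  open RedVHC C renaming (perm to π; hooks to H)
  open IsValidHookConfiguration isVHC

  word : Ballot 0 0 k
  word = proj₁ (Simulation.word refl C)

  private
    module B = Build word (sym (positions≡ word))

    word-at : ∀ i → At word (toℕ i) (toℕ (π ⟨$⟩ʳ i))
    word-at = proj₁ (proj₂ (Simulation.word refl C))

    perm-word : B.π Perm.≈ π
    perm-word i = toℕ-injective (at-functional word (B.π-at i) (word-at i))

    H⊆ : ∀ {i j} → (i , j) ∈ₚ H → (i , j) ∈ₚ B.H
    H⊆ h = B.hook⇒∈H (proj₂ (proj₂ (Simulation.word refl C)) h)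

    -- Equal permutations have the same descent tops, so `H` also has a hook from `i`. By `H⊆` it is
    -- a hook of the word, and the word has only one hook from `i`.
    ⊆H : ∀ {i j} → (i , j) ∈ₚ B.H → (i , j) ∈ₚ H
    ⊆H {i} {j} h with Equivalence.to (IsValidHookConfiguration.swEndpoints B.valid i) (j , h)
    ... | i⁺ , eq , gt with Equivalence.from (swEndpoints i)
            (i⁺ , eq , subst₂ Fin._<_ (perm-word i⁺) (perm-word i) gt)
    ...   | j′ , h′ = subst (λ j → (i , j) ∈ₚ H)
            (toℕ-injective (hook-functional word (B.∈H⇒hook (H⊆ h′)) (B.∈H⇒hook h))) h′

    hooks-word : B.H ≡ H
    hooks-word = trans (sym (tabulate∘lookup B.H))
      (trans (tabulate-cong λ i → ⊆-antisym ⊆H H⊆) (tabulate∘lookup H))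

  config-word : Setoid._≈_ (redVHC-setoid k (Av312 (3 * k))) (config word) C
  config-word = perm-word , hooks-word

corollary3p2p1 : ∀ (k : ℕ) → k ≥ 1 →
    ∃[ N ] (HasCardinality (redVHC-setoid k (Av312 (3 * k))) N ×
    N * ((k !) * ((k + 1) !) * ((k + 2) !)) ≡ 2 * ((3 * k) !))
corollary3p2p1 k _ = count 0 0 k , record
  { to        = config ∘ Inverse.to words
  ; cong      = λ { refl → (λ _ → refl) , refl }
  ; bijective = (λ (π≈ , _) → Injection.injective (↔⇒↣ words) (perm-injective _ _ π≈)) , surjective
  } , count-00k k
  where
  words = count↔ 0 0 k

  surjective : ∀ C → ∃[ i ] (∀ {j} → j ≡ i →
    Setoid._≈_ (redVHC-setoid k (Av312 (3 * k))) (config (Inverse.to words j)) C)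
  surjective C = Inverse.from words (word C) , λ { refl →
    subst (λ w → Setoid._≈_ (redVHC-setoid k (Av312 (3 * k))) (config w) C)
      (sym (Inverse.strictlyInverseˡ words (word C))) (config-word C) }
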